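{- Let $L$ be a skew basic $(p,q)$-leaper, $p<q$, $D$ a canonical second leaper cycle of a skew basic canonical second leaper over the squares of a cycle $C$ of $L$ within a $(p+q)\times(p+q)$ chessboard, $e$ the descent of $D$, and $o$ the origin of $D$. Then $D$ is trivial and the direction graph extracted from $D$ depends only on $e$ and $o$. Equivalently, let $C$ be a cycle of type $k$. Then the direction graph extracted from $D$ depends only on the $k$-th convergent $[c_1\pm,c_2\pm,\ldots,c_k]$ of the even continued fraction representation of $\frac qp$ and the sign following $c_k$ in that representation.
   Context: Leapers. A square is a unit square of the infinite chessboard. A $(p,q)$-leaper is a piece that moves from a square $a$ to any of $a+(\pm p,\pm q)$, $a+(\pm q,\pm p)$. The leaper graph of $L$ over a set of squares $B$ has the squares of $B$ as vertices, two being adjacent when a move of $L$ joins them; a cycle of $L$ within $B$ is a simple cycle in this graph. The leaper is basic if $p+q$ is odd and $\gcd(p,q)=1$, and skew if $p,q$ are nonzero and distinct. Frames. Let $m<n$ be coprime positive integers with $m+n$ odd. Identify squares with their centers, the centers being the points of $\mathbb Z^2$. The $(m,n)$-frame $F$ is the set of squares $(x,y)$ with $\frac{n-m}2<\max(|x|,|y|)<\frac{m+n}2$, i.e. an $(m+n)\times(m+n)$ board with an $(n-m)\times(n-m)$ central hole. Its section $F_{\mathtt E}$ consists of the squares with $\frac{n-m}2<x<\frac{m+n}2$, $|y|<\frac{n-m}2$; its section $F_{\mathtt{NE}}$ of those with $\frac{n-m}2<x,y<\frac{m+n}2$; the sections $F_{\mathtt N},F_{\mathtt{NW}},F_{\mathtt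 W},F_{\mathtt{SW}},F_{\mathtt S},F_{\mathtt{SE}}$ are obtained by counterclockwise rotations by multiples of $90^\circ$ about the origin. In the leaper graph of the $(m,n)$-leaper over the $(m+n)\times(m+n)$ board the squares of the hole are isolated and all squares of $F$ have degree two, so a cycle is determined by its vertex set. Lifting. The lifting transformations $\mathtt f,\mathtt g,\mathtt h$ take $S\subseteq F$ to the disjoint union of $(S+v_i)\cap H_i$ over the eight directions $i$, where $H$ is respectively the $(m,2m+n)$-, $(n,2n-m)$-, $(n,m+2n)$-frame, and for $\mathtt f$: $v_{\mathtt E}=(m+n,0)$, $v_{\mathtt{NE}}=(m,m)$; for $\mathtt g$: $v_{\mathtt E}=(n-m,0)$, $v_{\mathtt{NE}}=(n,n)$; for $\mathtt h$: $v_{\mathtt E}=(m+n,0)$, $v_{\mathtt{NE}}=(n,n)$; the other $v_i$ are obtained by $90^\circ$ rotations. Each maps the vertex set of a cycle of the $(m,n)$-leaper within $F$ to the vertex set of a cycle of the leaper with the proportions of $H$ within $H$; this defines the lift of a cycle. Shell. Let $n\le3m$. If $2m\ge n$, the shell of $F$ is the union of eight $(n-m)\times(n-m)$ subboards: the four corners of $F$ and the four adjacent by side to the central hole. If $2m\le n\le3m$, it is the union of eight $(3m-n)\times(3m-n)$ subboards: one in the middle of each outer side and four adjacent by corner to the central hole. (When $n=2m$ both give all of $F$.) The shell is a union of eight-square cycles of the $(m,n)$-leaper, called shell cycles; each visits exactly one square in each section. Descents. The descent of a skew basic $(p,q)$-leaper, $p<q$, is the unique string $e_1\ldots e_l$ of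 characters $\mathtt f,\mathtt g,\mathtt h$ such that successively applying lifting transformations of types $e_l,\ldots,e_1$ to a $(1,2)$-frame gives a $(p,q)$-frame. The descent of a cycle $C$ of $L$ within a $(p+q)\times(p+q)$ board is the prefix $e_1\ldots e_j$ of the descent of $L$ such that $C$ is obtained from a shell cycle $C'$ of the frame $F'$ whose leaper has descent $e_{j+1}\ldots e_l$ by successively applying lifting transformations of types $e_j,\ldots,e_1$. Either $j=l$ and $F'$ is a $(1,2)$-frame, or $j<l$ and $e_{j+1}\in\{\mathtt g,\mathtt h\}$. Canonical second leaper cycles. Let $L$ be a skew basic $(p,q)$-leaper, $p<q$, of descent $e_1\ldots e_l$, let $C$ be a cycle of $L$ of descent $e_1\ldots e_j$ within a $(p+q)\times(p+q)$ board, let $F'$ be the frame whose leaper has descent $e_{j+1}\ldots e_l$, and let $C'$ be the shell cycle of $F'$ from which $C$ is obtained by successively applying lifting transformations of types $e_j,\ldots,e_1$. The canonical second leaper $M$ associated with $C$ is the $(0,1)$-leaper if $j=l$, and the skew basic leaper of descent $e_{j+2}\ldots e_l$ if $j<l$. The canonical second leaper cycle over the squares of $C'$ is the cycle of $M$ visiting the eight squares of $C'$ in the order of their sections $\mathtt E,\mathtt{NE},\mathtt N,\mathtt{NW},\mathtt W,\mathtt{SW},\mathtt S,\mathtt{SE}$, written as a concatenation $a_0a_1\ldots a_7$ of eight one-square paths. Number the directions $\mathtt E,\mathtt{NE},\ldots,\mathtt{SE}$ by $0,\ldots,7$ modulo $8$, let $u_0=(1,0)$, $u_1=(1,1)$,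 $u_2=(0,1)$, $u_3=(-1,1)$, $u_{i+4}=-u_i$, and let $-w$ be the path $w$ traversed backwards. A cycle $a_0a_1\ldots a_7$ of $M$ within an $(m,n)$-frame, split into eight paths with $a_i$ in the section of direction $i$, is lifted to $b_0b_1\ldots b_7$ within the larger frame by the rules: $\mathtt f$: $b_i=(-a_{i+5})(-a_{i+4})(-a_{i+3})+(m+n)u_i$ for $i$ even, $b_i=a_i+mu_i$ for $i$ odd; $\mathtt g$: $b_i=a_i+(n-m)u_i$ for $i$ even, $b_i=(-a_{i+5})(-a_{i+4})(-a_{i+3})+nu_i$ for $i$ odd; $\mathtt h$: $b_i=(-a_{i+6})(-a_{i+5})(-a_{i+4})(-a_{i+3})(-a_{i+2})+(m+n)u_i$ for $i$ even, $b_i=a_{i-1}a_ia_{i+1}+nu_i$ for $i$ odd. The canonical second leaper cycle $D$ over the squares of $C$ is obtained from the one over the squares of $C'$ by successively applying the lifts of types $e_j,\ldots,e_1$; it is a Hamiltonian cycle of $M$ over the squares of $C$. When $M$ is skew (so $j<l$), the descent of $D$ is $e_1\ldots e_j$ and the origin of $D$ is $e_{j+1}\in\{\mathtt g,\mathtt h\}$. Even continued fractions and types. $[c_1\pm,\ldots,c_K]=c_1\pm\cfrac1{c_2\pm\cfrac1{\ddots\pm\frac1{c_K}}}$, with independent signs, all $c_i$ even integers, $c_1\ge0$, $c_2,\ldots,c_K>0$; every $\frac qp$ with $p,q$ coprime and $p+q$ odd has a unique such representation, and its $k$-th convergent is $[c_1\pm,\ldots,c_k]$ with the same signs. The descent of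 $L$ is $\mathtt f^{c_1/2-1}x_1\mathtt f^{c_2/2-1}x_2\cdots x_{K-1}\mathtt f^{c_K/2-1}$, where $x_i=\mathtt g$ if the sign following $c_i$ is $-$ and $x_i=\mathtt h$ if it is $+$. A cycle $C$ is of type $k$ if its descent is $\mathtt f^{c_1/2-1}x_1\cdots x_{k-1}\mathtt f^{c_k/2-1}$. Direction graphs. Let $A_1=\begin{pmatrix}0&1\\1&0\end{pmatrix}$, $A_2=\begin{pmatrix}1&0\\0&1\end{pmatrix}$, $A_3=\begin{pmatrix}-1&0\\0&1\end{pmatrix}$, $A_4=\begin{pmatrix}0&-1\\1&0\end{pmatrix}$, and $A_{i+4}=-A_i$ for $i=1,\ldots,4$. A move of a skew $(r,s)$-leaper, $r<s$, by a translation $v$ has (skew) direction $i\in\{1,\ldots,8\}$ and direction matrix $A_i$ if $v^T=A_i\binom rs$. A direction graph is a symmetric directed graph whose arcs are labeled with skew directions so that the sum of the associated direction matrices over every simple directed cycle (including two-cycles) is zero. Two direction graphs are the same if there is a label-preserving isomorphism between them. A simple cycle of a skew leaper is trivial if the sum of the direction matrices of its moves (in either orientation) is the zero matrix. The direction graph extracted from a trivial cycle $D$ has the squares of $D$ as vertices and, for each pair of squares $a,b$ consecutive in $D$, an arc from $a$ to $b$ and an arc from $b$ to $a$, each labeled with the direction of the corresponding move. "Depends only on" means that it is the same for all leapers $L$ and cycles $D$ with the same data. -}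

module Defs where

open import Data.Bool using (Bool; true; false; if_then_else_)
open import Data.Fin using (Fin; zero; suc; toℕ)
open import Data.Integer using (ℤ; +_; -_; 0ℤ; 1ℤ; -1ℤ; _◃_)
open import Data.List using (List; []; _∷_; _++_; _∷ʳ_; [_]; foldr; map; zip; concatMap; allFin; length; replicate; reverse; head)
open import Data.List.Membership.Propositional using (_∈_)
open import Data.List.Relation.Binary.Pointwise using (Pointwise)
open import Data.List.Relation.Unary.All using (All)
open import Data.List.Relation.Unary.Unique.Propositional using (Unique)
open import Data.Maybe using (Maybe; just; nothing)
open import Data.Nat using (ℕ; zero; suc; _+_; _*_; _∸_; _≤_; _<_; _/_; _%_; _≡ᵇ_; ≢-nonZero)
open import Data.Nat.Divisibility using (_∣_)
open import Data.Nat.DivMod using (_mod_)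
open import Data.Nat.GCD using (gcd)
open import Data.Product using (_×_; _,_; ∃; ∃₂; Σ; proj₁; uncurry)
open import Data.Rational using (ℚ; 1/_)
open import Data.Sign using (Sign)
open import Data.Sum using (_⊎_)
open import Function.Bundles using (_⇔_; _↔_; Inverse)
open import Relation.Binary.PropositionalEquality using (_≡_; _≢_)
open import Relation.Unary using (Pred)
open import Level using (0ℓ)

import Data.Integer as ℤ
import Data.Rational as ℚ
import Data.Sign as Sign

Square : Set
Square = ℤ × ℤ

infixl 6 _⊕_ _⊖_
infixl 7 _⊛_

_⊕_ : Square → Square → Square
(x , y) ⊕ (x′ , y′) = x ℤ.+ x′ , y ℤ.+ y′

_⊖_ : Square → Square → Square
(x , y) ⊖ (x′ , y′) = x ℤ.- x′ , y ℤ.- y′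

_⊛_ : ℤ → Square → Square
k ⊛ (x , y) = k ℤ.* x , k ℤ.* y

Leaper : Set
Leaper = ℕ × ℕ

Basic : Leaper → Set
Basic (p , q) = (p + q) % 2 ≡ 1 × gcd p q ≡ 1

Skew : Leaper → Set
Skew (p , q) = p ≢ 0 × q ≢ 0 × p ≢ q

Translation : Leaper → Pred Square 0ℓ
Translation (p , q) v =
  ∃₂ λ (s t : Sign) → v ≡ (s ◃ p , t ◃ q) ⊎ v ≡ (s ◃ q , t ◃ p)

Move : Leaper → Square → Square → Set
Move L a b = Translation L (b ⊖ a)

-- The steps of x₀ x₁ … xₖ regarded as a closed walk, the last one being
-- from xₖ back to x₀.
steps : {V : Set} → List V → List (V × V)
steps []       = []
steps (x ∷ xs) = zip (x ∷ xs) (xs ∷ʳ x)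

record IsCycle (L : Leaper) (C : List Square) : Set where
  field
    long   : 3 ≤ length C
    simple : Unique C
    moves  : All (uncurry (Move L)) (steps C)

-- Half-integer bounds are doubled: 2x lies strictly between x₀ and x₁, and
-- 2y between y₀ and y₁.
Box : (x₀ x₁ y₀ y₁ : ℤ) → Pred Square 0ℓ
Box x₀ x₁ y₀ y₁ (x , y) =
  (x₀ ℤ.< + 2 ℤ.* x × + 2 ℤ.* x ℤ.< x₁) ×
  (y₀ ℤ.< + 2 ℤ.* y × + 2 ℤ.* y ℤ.< y₁)

Board : ℕ → Pred Square 0ℓ
Board k = Box (- + k) (+ k) (- + k) (+ k)

-- E, NE, N, NW, W, SW, S, SE are 0, …, 7.
Direction : Set
Direction = Fin 8

turn : Direction → ℕ → Direction
turn i k = (toℕ i + k) mod 8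

isEven : Direction → Bool
isEven i = toℕ i % 2 ≡ᵇ 0

unit : Direction → Square
unit i = u (toℕ i)
  where
  u : ℕ → Square
  u 0 = 1ℤ , 0ℤ
  u 1 = 1ℤ , 1ℤ
  u 2 = 0ℤ , 1ℤ
  u 3 = -1ℤ , 1ℤ
  u (suc (suc (suc (suc i)))) = -1ℤ ⊛ u i

clockwise : Square → Square
clockwise (x , y) = y , - x

-- The images of an E region and an NE region under the counterclockwise
-- rotations by multiples of 90°.
rotations : Pred Square 0ℓ → Pred Square 0ℓ → Direction → Pred Square 0ℓ
rotations P Q i = R (toℕ i)
  where
  R : ℕ → Pred Square 0ℓ
  R 0             a = P a
  R 1             a = Q a
  R (suc (suc i)) a = R i (clockwise a)

-- A frame, centered at the origin, is given by its proportions (m , n), m < n.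
Frame : Set
Frame = ℕ × ℕ

Section : Frame → Direction → Pred Square 0ℓ
Section (m , n) = rotations (Box h b (- h) h) (Box h b h b)
  where
  h = + n ℤ.- + m
  b = + n ℤ.+ + m

-- The eight subboards, of side n - m, when n ≤ 2m.
NarrowShell : Frame → Direction → Pred Square 0ℓ
NarrowShell (m , n) =
  rotations (Box h (h ℤ.+ + 2 ℤ.* d) (- d) d)
            (Box (b ℤ.- + 2 ℤ.* d) b (b ℤ.- + 2 ℤ.* d) b)
  where
  h = + n ℤ.- + m
  b = + n ℤ.+ + m
  d = + n ℤ.- + m

-- The eight subboards, of side 3m - n, when 2m ≤ n ≤ 3m.
WideShell : Frame → Direction → Pred Square 0ℓ
WideShell (m , n) =
  rotations (Box (b ℤ.- + 2 ℤ.* d) b (- d) d)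
            (Box h (h ℤ.+ + 2 ℤ.* d) h (h ℤ.+ + 2 ℤ.* d))
  where
  h = + n ℤ.- + m
  b = + n ℤ.+ + m
  d = + 3 ℤ.* + m ℤ.- + n

Shell : Frame → Pred Square 0ℓ
Shell (m , n) a =
  (n ≤ 2 * m × ∃ λ i → NarrowShell (m , n) i a) ⊎
  (2 * m ≤ n × n ≤ 3 * m × ∃ λ i → WideShell (m , n) i a)

record IsShellCycle (F : Frame) (C : List Square) : Set where
  field
    isCycle : IsCycle F C
    eight   : length C ≡ 8
    inShell : All (Shell F) C

data LiftType : Set where
  𝚏 𝚐 𝚑 : LiftType

enlarge : LiftType → Frame → Frame
enlarge 𝚏 (m , n) = m , 2 * m + n
enlarge 𝚐 (m , n) = n , 2 * n ∸ m
enlarge 𝚑 (m , n) = n , m + 2 * n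

shift : LiftType → Frame → Direction → Square
shift x F i = (if isEven i then side x F else corner x F) ⊛ unit i
  where
  side corner : LiftType → Frame → ℤ
  side 𝚏 (m , n) = + m ℤ.+ + n
  side 𝚐 (m , n) = + n ℤ.- + m
  side 𝚑 (m , n) = + m ℤ.+ + n
  corner 𝚏 (m , n) = + m
  corner 𝚐 (m , n) = + n
  corner 𝚑 (m , n) = + n

liftSet : LiftType → Frame → Pred Square 0ℓ → Pred Square 0ℓ
liftSet x F S b = ∃ λ i → Section (enlarge x F) i b × S (b ⊖ shift x F i)

-- A cycle a₀a₁…a₇ split into eight paths.
Paths : Set
Paths = Direction → List Square

join : Paths → List Square
join a = concatMap a (allFin 8)

liftPaths : LiftType → Frame → Paths → Paths
liftPaths x F a i =
  map (_⊕ shift x F i) (if isEven i then side x else corner x)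
  where
  fwd bwd : ℕ → List Square
  fwd k = a (turn i k)
  bwd k = reverse (fwd k)

  side corner : LiftType → List Square
  side 𝚏 = bwd 5 ++ bwd 4 ++ bwd 3
  side 𝚐 = fwd 0
  side 𝚑 = bwd 6 ++ bwd 5 ++ bwd 4 ++ bwd 3 ++ bwd 2
  corner 𝚏 = fwd 0
  corner 𝚐 = bwd 5 ++ bwd 4 ++ bwd 3
  corner 𝚑 = fwd 7 ++ fwd 0 ++ fwd 1

-- The string e₁ … eₗ; its last character is applied first.
Descent : Set
Descent = List LiftType

enlarge* : Descent → Frame → Frame
enlarge* e F = foldr enlarge F e

HasDescent : Leaper → Descent → Set
HasDescent L e = enlarge* e (1 , 2) ≡ L

liftSet* : Descent → Frame → Pred Square 0ℓ → Pred Square 0ℓ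
liftSet* []      F S = S
liftSet* (x ∷ e) F S = liftSet x (enlarge* e F) (liftSet* e F S)

liftPaths* : Descent → Frame → Paths → Paths
liftPaths* []      F a = a
liftPaths* (x ∷ e) F a = liftPaths x (enlarge* e F) (liftPaths* e F a)

-- C is obtained from the shell cycle C′ of the frame F′, whose leaper has
-- descent t, by liftings of types e; the descent of the leaper of C is e ++ t.
record Descends (L : Leaper) (C : List Square) (e t : Descent)
                (F′ : Frame) (C′ : List Square) : Set where
  field
    descent    : HasDescent L (e ++ t)
    frame      : HasDescent F′ t
    shellCycle : IsShellCycle F′ C′
    lifted     : ∀ a → a ∈ C ⇔ liftSet* e F′ (_∈ C′) a

canonicalSecondLeaper : Descent → Leaper
canonicalSecondLeaper []      = 0 , 1
canonicalSecondLeaper (_ ∷ t) = enlarge* t (1 , 2)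

-- D is the canonical second leaper cycle of the skew basic leaper M over the
-- squares of the cycle C of L.
record CanonicalCycle : Set where
  field
    p q     : ℕ
    L-skew  : Skew (p , q)
    L-basic : Basic (p , q)
    p<q     : p < q

    C         : List Square
    C-cycle   : IsCycle (p , q) C
    C-onBoard : All (Board (p + q)) C

    e t      : Descent
    F′       : Frame
    C′       : List Square
    descends : Descends (p , q) C e t F′ C′

    M         : Leaper
    canonical : M ≡ canonicalSecondLeaper t
    M-skew    : Skew M
    M-basic   : Basic M

    a          : Direction → Square
    a∈C′       : ∀ i → a i ∈ C′
    a∈Section  : ∀ i → Section F′ i (a i)

    o      : LiftType
    origin : head t ≡ just o

  D : List Square
  D = join (liftPaths* e F′ (λ i → [ a i ]))

Matrix : Set
Matrix = (ℤ × ℤ) × (ℤ × ℤ)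

infixl 6 _⊞_

_⊞_ : Matrix → Matrix → Matrix
(r₁ , r₂) ⊞ (s₁ , s₂) = r₁ ⊕ s₁ , r₂ ⊕ s₂

O : Matrix
O = (0ℤ , 0ℤ) , (0ℤ , 0ℤ)

_·_ : Matrix → ℤ × ℤ → ℤ × ℤ
((a , b) , (c , d)) · (x , y) = a ℤ.* x ℤ.+ b ℤ.* y , c ℤ.* x ℤ.+ d ℤ.* y

-- The skew directions 1, …, 8 are numbered from zero here.
SkewDirection : Set
SkewDirection = Fin 8

directionMatrix : SkewDirection → Matrix
directionMatrix i = A (toℕ i)
  where
  A : ℕ → Matrix
  A 0 = (0ℤ , 1ℤ) , (1ℤ , 0ℤ)
  A 1 = (1ℤ , 0ℤ) , (0ℤ , 1ℤ)
  A 2 = (-1ℤ , 0ℤ) , (0ℤ , 1ℤ)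
  A 3 = (0ℤ , -1ℤ) , (1ℤ , 0ℤ)
  A (suc (suc (suc (suc i)))) with A i
  ... | r₁ , r₂ = -1ℤ ⊛ r₁ , -1ℤ ⊛ r₂

directionSum : List SkewDirection → Matrix
directionSum ds = foldr _⊞_ O (map directionMatrix ds)

HasDirection : Leaper → Square → Square → SkewDirection → Set
HasDirection (r , s) a b d = b ⊖ a ≡ directionMatrix d · (+ r , + s)

record Trivial (M : Leaper) (D : List Square) : Set where
  field
    isCycle    : IsCycle M D
    directions : List SkewDirection
    directed   : Pointwise (λ (a , b) → HasDirection M a b) (steps D) directions
    zeroSum    : directionSum directions ≡ O

record LabeledGraph : Set₁ where
  field
    Vertex : Set
    Arc    : Vertex → Vertex → SkewDirection → Set

-- That an arc has only one label follows from the case of two-cycles.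
record IsDirectionGraph (G : LabeledGraph) : Set where
  open LabeledGraph G
  field
    symmetric : ∀ {a b d} → Arc a b d → ∃ λ d′ → Arc b a d′
    zeroSum   : ∀ (vs : List Vertex) (ds : List SkewDirection) → Unique vs →
                Pointwise (λ (a , b) → Arc a b) (steps vs) ds →
                directionSum ds ≡ O

record _≅_ (G H : LabeledGraph) : Set where
  private
    module G = LabeledGraph G
    module H = LabeledGraph H
  field
    vertices : G.Vertex ↔ H.Vertex
  open Inverse vertices using (to)
  field
    arcs : ∀ a b d → G.Arc a b d ⇔ H.Arc (to a) (to b) d

extracted : Leaper → List Square → LabeledGraph
extracted M D = record
  { Vertex = Σ Square (_∈ D)
  ; Arc    = λ (a , _) (b , _) d →
      ((a , b) ∈ steps D ⊎ (b , a) ∈ steps D) × HasDirection M a b d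
  }

graph : CanonicalCycle → LabeledGraph
graph X = extracted M D
  where open CanonicalCycle X

-- c ⟨ s ⟩ r stands for c s 1/r.
data ContinuedFraction : Set where
  ⟦_⟧   : ℕ → ContinuedFraction
  _⟨_⟩_ : ℕ → Sign → ContinuedFraction → ContinuedFraction

infixr 5 _⟨_⟩_

addSigned : ℚ → Sign → ℚ → ℚ
addSigned x Sign.+ y = x ℚ.+ y
addSigned x Sign.- y = x ℚ.- y

infix 4 _⇓_

data _⇓_ : ContinuedFraction → ℚ → Set where
  term : ∀ c → ⟦ c ⟧ ⇓ (+ c ℚ./ 1)
  more : ∀ c s {r v} .{{_ : ℚ.NonZero v}} → r ⇓ v →
         c ⟨ s ⟩ r ⇓ addSigned (+ c ℚ./ 1) s (1/ v)

AllPositiveEven : ContinuedFraction → Set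
AllPositiveEven ⟦ c ⟧       = 2 ∣ c × 0 < c
AllPositiveEven (c ⟨ _ ⟩ r) = (2 ∣ c × 0 < c) × AllPositiveEven r

IsEvenFraction : ContinuedFraction → Set
IsEvenFraction ⟦ c ⟧       = 2 ∣ c
IsEvenFraction (c ⟨ _ ⟩ r) = 2 ∣ c × AllPositiveEven r

terms : ContinuedFraction → ℕ
terms ⟦ _ ⟧       = 1
terms (_ ⟨ _ ⟩ r) = suc (terms r)

-- [c₁±,…,cₖ] and the sign following cₖ, the index being k - 1.
convergent : (c : ContinuedFraction) → Fin (terms c) → ContinuedFraction
convergent ⟦ c ⟧       _       = ⟦ c ⟧
convergent (c ⟨ _ ⟩ _) zero    = ⟦ c ⟧
convergent (c ⟨ s ⟩ r) (suc k) = c ⟨ s ⟩ convergent r k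

signAfter : (c : ContinuedFraction) → Fin (terms c) → Maybe Sign
signAfter ⟦ _ ⟧       _       = nothing
signAfter (_ ⟨ s ⟩ _) zero    = just s
signAfter (_ ⟨ _ ⟩ r) (suc k) = signAfter r k

signLift : Sign → LiftType
signLift Sign.- = 𝚐
signLift Sign.+ = 𝚑

-- 𝚏^(c₁/2-1) x₁ ⋯ xₖ₋₁ 𝚏^(cₖ/2-1).  All terms are at least 2, the first one
-- because q/p > 1.
fractionDescent : ContinuedFraction → Descent
fractionDescent ⟦ c ⟧       = replicate (c / 2 ∸ 1) 𝚏
fractionDescent (c ⟨ s ⟩ r) =
  replicate (c / 2 ∸ 1) 𝚏 ++ signLift s ∷ fractionDescent r

-- The cycle C of X is of type k; again the index is k - 1.
record HasType (X : CanonicalCycle) : Set where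
  open CanonicalCycle X
  field
    fraction : ContinuedFraction
    isEvenFraction : IsEvenFraction fraction
    value    : fraction ⇓ (+ q ℚ./ p) {{≢-nonZero (proj₁ L-skew)}}
    k        : Fin (terms fraction)
    isType   : e ≡ fractionDescent (convergent fraction k)

  kthConvergent : ContinuedFraction
  kthConvergent = convergent fraction k

  nextSign : Maybe Sign
  nextSign = signAfter fraction k

{-# OPTIONS --safe #-}
module Submission where

-- Let M be an (r , s)-leaper. Every square of a canonical second leaper cycle
-- D of M can be written c ⊕ A · (r , s), where the square c depends on D but
-- the matrix A depends only on the place of the square in D, on the descent e
-- and on the origin o. So D is the image, under A ↦ c ⊕ A · (r , s), of a
-- formal cycle of matrices, formalCycle e o, and its direction graph can be
-- read off the formal cycle.
--
-- The frame F′ of the shell cycle is obtained from M, regarded as a frame, by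
-- one lift of type o, and the eight subboards of its shell are centered at the
-- points by which that lift translates the eight directions. A move of the
-- leaper of F′ between two shell squares preserves the offset of a square from
-- the center of its subboard (shell-move); hence a shell cycle consists of
-- translates by one vector c of the eight centers (shellCycle-translate). This
-- is the only place where the cycle structure of C′ matters.
--
-- Lifting is then imitated on matrices. The invariant (Coherent) is that the
-- eight formal paths are joined by formal steps A ↦ A ⊞ directionMatrix d,
-- together with the fact that the end of the i-th path differs from the start
-- of the (i + 3)-rd by a specific move of the leaper of the current frame. The
-- second part makes the steps between the blocks of a lifted cycle translates
-- of steps of the old one (liftFormal-coherent).
--
-- Distinctness of the squares of D is proved on the board: a lift moves all
-- squares of a block by one vector, and different blocks into different
-- sections of the larger frame (liftPaths-placed).
--
-- Given this, the matrices are a potential for the labels: an arc labeled d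
-- from A to B satisfies B ≡ A ⊞ directionMatrix d, so the direction matrices
-- along any closed walk telescope to zero (telescope). This gives triviality
-- and the direction graph property at once, and two cycles with the same e and
-- o realize the same formal cycle, so that matching squares with equal matrices
-- is an isomorphism (realizations-isomorphic).
--
-- For the version with continued fractions, the frame obtained from (1 , 2) by
-- the descent of an even continued fraction has the value of the fraction as
-- the ratio of its proportions (fraction-ratio), and this ratio determines the
-- descent, the type of the last lift being recognizable from the comparison of
-- the ratio with 2 and 3 (descent-unique). So the convergent determines e, and
-- comparing the two descriptions of the descent of L identifies o with the lift
-- type of the sign after the convergent (origin-nextSign).

open import Defs
open import Data.Product using (_×_)
open import Relation.Binary.PropositionalEquality using (_≡_)
open import Data.Bool using (Bool; true; false; not; if_then_else_)
import Data.Bool.Properties as Bool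
open import Data.Empty using (⊥-elim)
open import Data.Fin using (Fin; zero; suc; toℕ)
open import Data.Fin.Patterns
import Data.Fin.Properties as Fin
open import Data.Integer using (ℤ; +_; -_; 0ℤ; 1ℤ; -1ℤ; _◃_)
import Data.Integer as ℤ
import Data.Integer.Properties as ℤ
open import Data.Integer.Tactic.RingSolver using (solve-∀)
open import Data.List using (List; []; _∷_; _++_; _∷ʳ_; [_]; map; zip; concatMap; reverse; length; head; replicate)
open import Data.List.Membership.Propositional using (_∈_)
open import Data.List.Membership.Propositional.Properties using (∈-map⁺; ∈-map⁻; ∈-++⁻)
open import Data.List.Membership.Propositional.Properties.WithK using (unique⇒irrelevant)
import Data.List.Properties as List
open import Data.List.Relation.Binary.Disjoint.Propositional using (Disjoint)
open import Data.List.Relation.Binary.Permutation.Propositional using (↭⇒↭ₛ; ↭-sym)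
open import Data.List.Relation.Binary.Permutation.Propositional.Properties using (↭-reverse; All-resp-↭)
import Data.List.Relation.Binary.Permutation.Setoid.Properties as Permutation
open import Data.List.Relation.Binary.Pointwise as Pointwise using (Pointwise; []; _∷_)
open import Data.List.Relation.Unary.All as All using (All; []; _∷_)
import Data.List.Relation.Unary.All.Properties as All
import Data.List.Relation.Unary.AllPairs as AllPairs
import Data.List.Relation.Unary.AllPairs.Properties as AllPairs
open import Data.List.Relation.Unary.Any using (here; there)
open import Data.List.Relation.Unary.Any.Properties using (¬Any[])
import Data.List.Relation.Unary.Unique.DecPropositional as DecUnique
open import Data.List.Relation.Unary.Unique.Propositional using (Unique; []; _∷_)
import Data.List.Relation.Unary.Unique.Propositional.Properties as Unique
open import Data.Maybe using (just)
import Data.Maybe as Maybe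
open import Data.Maybe.Properties using (just-injective)
open import Data.Nat using (ℕ; zero; suc; _+_; _*_; _∸_; _≤_; _<_; z≤n; s≤s)
import Data.Nat as ℕ
open import Data.Nat.Divisibility using (_∣_; divides)
open import Data.Nat.DivMod using (_%_; _mod_; m%n<n; m%n%n≡m%n; m*n/n≡m; %-distribˡ-+)
import Data.Nat.Properties as ℕ
open import Data.Nat.Tactic.RingSolver renaming (solve-∀ to solveℕ-∀)
open import Data.Product as Product using (_,_; ∃; proj₁; proj₂; uncurry)
open import Data.Product.Properties using (≡-dec)
open import Data.Rational using (ℚ; 1/_; toℚᵘ)
import Data.Rational as ℚ
import Data.Rational.Properties as ℚ
open import Data.Rational.Unnormalised using (mkℚᵘ; *≡*)
import Data.Rational.Unnormalised as ℚᵘ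
import Data.Rational.Unnormalised.Properties as ℚᵘ
open import Data.Sign using (Sign)
open import Data.Sum as Sum using (_⊎_; inj₁; inj₂)
open import Function using (_∘_; id)
open import Function.Bundles using (mk⇔; mk↔ₛ′)
open import Level using (0ℓ)
open import Relation.Binary using (Decidable; DecidableEquality; Rel; Symmetric)
open import Relation.Binary.PropositionalEquality
  using (_≢_; refl; sym; trans; cong; cong₂; subst; subst₂; setoid; module ≡-Reasoning)
open import Relation.Nullary using (Dec; ¬_; contradiction)
open import Relation.Nullary.Decidable using (map′; toWitness; _×-dec_; _⊎-dec_)

-- Squares as vectors

infix 4 _≟²_ _≟⁴_

_≟²_ : DecidableEquality Square
_≟²_ = ≡-dec ℤ._≟_ ℤ._≟_

_≟⁴_ : DecidableEquality Matrix
_≟⁴_ = ≡-dec _≟²_ _≟²_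

⊕-assoc : ∀ a b c → (a ⊕ b) ⊕ c ≡ a ⊕ (b ⊕ c)
⊕-assoc (a , a′) (b , b′) (c , c′) = cong₂ _,_ (ℤ.+-assoc a b c) (ℤ.+-assoc a′ b′ c′)

⊕-comm : ∀ a b → a ⊕ b ≡ b ⊕ a
⊕-comm a b = cong₂ _,_ (ℤ.+-comm (proj₁ a) _) (ℤ.+-comm (proj₂ a) _)

⊖⇒⊕ : ∀ {a b v} → b ⊖ a ≡ v → b ≡ a ⊕ v
⊖⇒⊕ {a} {b} refl = cong₂ _,_ (lemma (proj₁ a) (proj₁ b)) (lemma (proj₂ a) (proj₂ b))
  where
  lemma : ∀ x y → y ≡ x ℤ.+ (y ℤ.- x)
  lemma = solve-∀

⊕⇒⊖ : ∀ {a b v} → b ≡ a ⊕ v → b ⊖ a ≡ v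
⊕⇒⊖ {a} {v = v} refl = cong₂ _,_ (lemma (proj₁ a) (proj₁ v)) (lemma (proj₂ a) (proj₂ v))
  where
  lemma : ∀ x y → x ℤ.+ y ℤ.- x ≡ y
  lemma = solve-∀

⊕-cancelˡ : ∀ a {b c} → a ⊕ b ≡ a ⊕ c → b ≡ c
⊕-cancelˡ a {b} eq = trans (sym (⊕⇒⊖ {a} refl)) (⊕⇒⊖ {a} eq)

⊕-cancelʳ : ∀ s {b c} → b ⊕ s ≡ c ⊕ s → b ≡ c
⊕-cancelʳ s {b} {c} eq = ⊕-cancelˡ s (trans (⊕-comm s b) (trans eq (⊕-comm c s)))

-- Matrices acting on vectors

infixl 7 _∙_ _◁_ _⊠_

-- A pair (a , b) also stands for the linear form a x + b y in the proportions
-- (x , y) of a frame or leaper; f ∙ v is its value at v.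
_∙_ : Square → Square → ℤ
(a , b) ∙ (x , y) = a ℤ.* x ℤ.+ b ℤ.* y

-- The form f ◁ A is f after the linear map A, as ∙-◁ shows.
_◁_ : Square → Matrix → Square
(a , b) ◁ (r₁ , r₂) = a ⊛ r₁ ⊕ b ⊛ r₂

-- The matrix product.
_⊠_ : Matrix → Matrix → Matrix
(r₁ , r₂) ⊠ A = r₁ ◁ A , r₂ ◁ A

∙-distribʳ-⊕ : ∀ v a b → (a ⊕ b) ∙ v ≡ a ∙ v ℤ.+ b ∙ v
∙-distribʳ-⊕ (x , y) (a , b) (a′ , b′) = lemma a b a′ b′ x y
  where
  lemma : ∀ a b a′ b′ x y →
          (a ℤ.+ a′) ℤ.* x ℤ.+ (b ℤ.+ b′) ℤ.* y ≡ (a ℤ.* x ℤ.+ b ℤ.* y) ℤ.+ (a′ ℤ.* x ℤ.+ b′ ℤ.* y)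
  lemma = solve-∀

∙-◁ : ∀ a A v → (a ◁ A) ∙ v ≡ a ∙ (A · v)
∙-◁ (a , b) ((c , d) , (e , f)) (x , y) = lemma a b c d e f x y
  where
  lemma : ∀ a b c d e f x y →
          (a ℤ.* c ℤ.+ b ℤ.* e) ℤ.* x ℤ.+ (a ℤ.* d ℤ.+ b ℤ.* f) ℤ.* y ≡
          a ℤ.* (c ℤ.* x ℤ.+ d ℤ.* y) ℤ.+ b ℤ.* (e ℤ.* x ℤ.+ f ℤ.* y)
  lemma = solve-∀

◁-distribʳ-⊕ : ∀ A a b → (a ⊕ b) ◁ A ≡ a ◁ A ⊕ b ◁ A
◁-distribʳ-⊕ ((c , d) , (e , f)) a b =
  cong₂ _,_ (∙-distribʳ-⊕ (c , e) a b) (∙-distribʳ-⊕ (d , f) a b)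

◁-assoc : ∀ a A B → (a ◁ A) ◁ B ≡ a ◁ (A ⊠ B)
◁-assoc a A ((c , d) , (e , f)) = cong₂ _,_ (∙-◁ a A (c , e)) (∙-◁ a A (d , f))

⊞-assoc : ∀ A B C → (A ⊞ B) ⊞ C ≡ A ⊞ (B ⊞ C)
⊞-assoc (a , a′) (b , b′) (c , c′) = cong₂ _,_ (⊕-assoc a b c) (⊕-assoc a′ b′ c′)

⊞-comm : ∀ A B → A ⊞ B ≡ B ⊞ A
⊞-comm (a , a′) (b , b′) = cong₂ _,_ (⊕-comm a b) (⊕-comm a′ b′)

⊞-identityʳ : ∀ A → A ⊞ O ≡ A
⊞-identityʳ A = cong₂ _,_ (cong₂ _,_ (ℤ.+-identityʳ _) (ℤ.+-identityʳ _))
                          (cong₂ _,_ (ℤ.+-identityʳ _) (ℤ.+-identityʳ _))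

⊞-cancelˡ : ∀ A {B C} → A ⊞ B ≡ A ⊞ C → B ≡ C
⊞-cancelˡ (a , a′) eq =
  cong₂ _,_ (⊕-cancelˡ a (cong proj₁ eq)) (⊕-cancelˡ a′ (cong proj₂ eq))

⊞-swapʳ : ∀ A B C → (A ⊞ B) ⊞ C ≡ (A ⊞ C) ⊞ B
⊞-swapʳ A B C = trans (⊞-assoc A B C) (trans (cong (A ⊞_) (⊞-comm B C)) (sym (⊞-assoc A C B)))

·-distribʳ-⊞ : ∀ v A B → (A ⊞ B) · v ≡ A · v ⊕ B · v
·-distribʳ-⊞ v (a , a′) (b , b′) = cong₂ _,_ (∙-distribʳ-⊕ v a b) (∙-distribʳ-⊕ v a′ b′)

·-⊠ : ∀ A B v → (A ⊠ B) · v ≡ A · (B · v)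
·-⊠ (a , a′) B v = cong₂ _,_ (∙-◁ a B v) (∙-◁ a′ B v)

⊠-distribʳ-⊞ : ∀ C A B → (A ⊞ B) ⊠ C ≡ A ⊠ C ⊞ B ⊠ C
⊠-distribʳ-⊞ C (a , a′) (b , b′) = cong₂ _,_ (◁-distribʳ-⊕ C a b) (◁-distribʳ-⊕ C a′ b′)

⊠-assoc : ∀ A B C → (A ⊠ B) ⊠ C ≡ A ⊠ (B ⊠ C)
⊠-assoc (a , a′) B C = cong₂ _,_ (◁-assoc a B C) (◁-assoc a′ B C)

-- Directions modulo eight

turn-turn : ∀ i j k → turn (turn i j) k ≡ turn i (j ℕ.+ k)
turn-turn i j k = Fin.toℕ-injective (begin
  toℕ (turn (turn i j) k)                 ≡⟨ toℕ-mod (toℕ (turn i j) ℕ.+ k) ⟩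
  (toℕ (turn i j) ℕ.+ k) % 8              ≡⟨ cong (λ n → (n ℕ.+ k) % 8) (toℕ-mod (toℕ i ℕ.+ j)) ⟩
  ((toℕ i ℕ.+ j) % 8 ℕ.+ k) % 8           ≡⟨ %-distribˡ-+ ((toℕ i ℕ.+ j) % 8) k 8 ⟩
  ((toℕ i ℕ.+ j) % 8 % 8 ℕ.+ k % 8) % 8   ≡⟨ cong (λ n → (n ℕ.+ k % 8) % 8) (m%n%n≡m%n (toℕ i ℕ.+ j) 8) ⟩
  ((toℕ i ℕ.+ j) % 8 ℕ.+ k % 8) % 8       ≡⟨ sym (%-distribˡ-+ (toℕ i ℕ.+ j) k 8) ⟩
  (toℕ i ℕ.+ j ℕ.+ k) % 8                 ≡⟨ cong (_% 8) (ℕ.+-assoc (toℕ i) j k) ⟩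
  (toℕ i ℕ.+ (j ℕ.+ k)) % 8               ≡⟨ sym (toℕ-mod (toℕ i ℕ.+ (j ℕ.+ k))) ⟩
  toℕ (turn i (j ℕ.+ k))                  ∎)
  where
  open ≡-Reasoning
  toℕ-mod : ∀ n → toℕ (n mod 8) ≡ n % 8
  toℕ-mod n = Fin.toℕ-fromℕ< (m%n<n n 8)

turn-suc : ∀ i k → turn (turn i k) 1 ≡ turn i (suc k)
turn-suc i k = trans (turn-turn i k 1) (cong (turn i) (ℕ.+-comm k 1))

-- The direction of the reversed move.
opposite : SkewDirection → SkewDirection
opposite d = turn d 4

opposite-cancels : ∀ d → directionMatrix d ⊞ directionMatrix (opposite d) ≡ O
opposite-cancels = toWitness {a? = Fin.all? λ d → directionMatrix d ⊞ directionMatrix (opposite d) ≟⁴ O} _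

-- Walks along a relation

-- Nonempty lists whose consecutive elements are related by R.
module Walks {A : Set} (R : Rel A 0ℓ) where

  infixr 5 _∷_
  -- Walk x xs y: the list xs starts at x and ends at y.
  data Walk : A → List A → A → Set where
    stop : ∀ x → Walk x [ x ] x
    _∷_ : ∀ {x y z xs} → R x y → Walk y xs z → Walk x (x ∷ xs) z

  connect : ∀ {x y z w xs ys} → Walk x xs y → R y z → Walk z ys w → Walk x (xs ++ ys) w
  connect (stop x) s q = s ∷ q
  connect (r ∷ p) s q = r ∷ connect p s q

  reverseWalk : Symmetric R → ∀ {x y xs} → Walk x xs y → Walk y (reverse xs) x
  reverseWalk R-sym (stop x) = stop x
  reverseWalk R-sym (_∷_ {x} {xs = xs} r p) =
    subst (λ l → Walk _ l x) (sym (List.unfold-reverse x xs))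
          (connect (reverseWalk R-sym p) (R-sym r) (stop x))

  mapWalk : ∀ {f : A → A} → (∀ {x y} → R x y → R (f x) (f y)) →
            ∀ {x y xs} → Walk x xs y → Walk (f x) (map f xs) (f y)
  mapWalk pres (stop x) = stop _
  mapWalk pres (r ∷ p) = pres r ∷ mapWalk pres p

  closed : ∀ {x y xs} → Walk x xs y → R y x → All (uncurry R) (steps xs)
  closed (stop x)     r = r ∷ []
  closed p@(_ ∷ _)     r = go p r
    where
    go : ∀ {x y z w xs} → Walk x (y ∷ xs) z → R z w → All (uncurry R) (zip (y ∷ xs) (xs ∷ʳ w))
    go (stop x)           r = r ∷ []
    go (q ∷ p@(stop _))     r = q ∷ go p r
    go (q ∷ p@(_ ∷ _))     r = q ∷ go p r

-- Formal steps

-- A formal square is a matrix A, standing for the square c ⊕ A · (r , s) of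
-- the cycle of an (r , s)-leaper, where c is fixed. A formal step stands for a
-- move of that leaper in a given direction.
record Step (A B : Matrix) : Set where
  constructor step
  field
    direction : SkewDirection
    moves     : B ≡ A ⊞ directionMatrix direction

move-back : ∀ {A B} d → B ≡ A ⊞ directionMatrix d → A ≡ B ⊞ directionMatrix (opposite d)
move-back {A} d refl = sym (trans (⊞-assoc A (directionMatrix d) (directionMatrix (opposite d)))
  (trans (cong (A ⊞_) (opposite-cancels d)) (⊞-identityʳ A)))

step-sym : Symmetric Step
step-sym (step d eq) = step (opposite d) (move-back d eq)

step-translate : ∀ T {A B} → Step A B → Step (A ⊞ T) (B ⊞ T)
step-translate T {A} (step d refl) = step d (⊞-swapʳ A (directionMatrix d) T)

open Walks Step

-- Lifts as concatenations of runs of paths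

-- Statements about all lift types and directions that involve no frame are
-- decided by evaluation.
all-lifts? : {P : LiftType → Direction → Set} →
             (∀ x i → Dec (P x i)) → Dec (∀ x i → P x i)
all-lifts? P? =
  map′ (λ { (p , q , r) 𝚏 → p ; (p , q , r) 𝚐 → q ; (p , q , r) 𝚑 → r })
       (λ p → p 𝚏 , p 𝚐 , p 𝚑)
       (Fin.all? (P? 𝚏) ×-dec Fin.all? (P? 𝚐) ×-dec Fin.all? (P? 𝚑))

-- In a lifted cycle, the path of direction i is a translate of the
-- concatenation of the paths of the directions turn i k for k from start x i to
-- start x i + extent x i, reversed when backward x i is true.
backward : LiftType → Direction → Bool
backward 𝚏 i = isEven i
backward 𝚐 i = not (isEven i)
backward 𝚑 i = isEven i

start extent : LiftType → Direction → ℕ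
start 𝚏 i = if isEven i then 3 else 0
start 𝚐 i = if isEven i then 0 else 3
start 𝚑 i = if isEven i then 2 else 7
extent 𝚏 i = if isEven i then 2 else 0
extent 𝚐 i = if isEven i then 0 else 2
extent 𝚑 i = if isEven i then 4 else 2

-- The directions turn i k , …, turn i (k + l).
arc : Direction → ℕ → ℕ → List Direction
arc i k zero    = [ turn i k ]
arc i k (suc l) = turn i k ∷ arc i (suc k) l

sources : LiftType → Direction → List Direction
sources x i = arc i (start x i) (extent x i)

orient : ∀ {A : Set} → Bool → List A → List A
orient b xs = if b then reverse xs else xs

-- The path of direction i after a lift of type x, before its translation. It is
-- polymorphic, as it serves squares and formal squares alike.
block : ∀ {A : Set} → LiftType → (Direction → List A) → Direction → List A
block x a i = orient (backward x i) (concatMap a (sources x i))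

turn-0 : ∀ i → turn i 0 ≡ i
turn-0 = toWitness {a? = Fin.all? λ i → _ Fin.≟ _} _

turn-8 : ∀ i k → turn i (8 ℕ.+ k) ≡ turn i k
turn-8 i k = trans (sym (turn-turn i 8 k)) (cong (λ j → turn j k) (turn-period i))
  where
  turn-period : ∀ i → turn i 8 ≡ i
  turn-period = toWitness {a? = Fin.all? λ i → _ Fin.≟ _} _

liftPaths-block : ∀ x F a i → liftPaths x F a i ≡ map (_⊕ shift x F i) (block x a i)
liftPaths-block x F a i = helper x
  where
  fwd bwd : ℕ → List Square
  fwd k = a (turn i k)
  bwd k = reverse (fwd k)

  reverse₃ : ∀ X Y Z → reverse Z ++ reverse Y ++ reverse X ≡ reverse (X ++ Y ++ Z ++ [])
  reverse₃ X Y Z = sym (begin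
    reverse (X ++ Y ++ Z ++ [])              ≡⟨ List.reverse-++ X _ ⟩
    reverse (Y ++ Z ++ []) ++ reverse X      ≡⟨ cong (_++ reverse X) (List.reverse-++ Y _) ⟩
    (reverse (Z ++ []) ++ reverse Y) ++ reverse X
      ≡⟨ List.++-assoc (reverse (Z ++ [])) _ _ ⟩
    reverse (Z ++ []) ++ reverse Y ++ reverse X
      ≡⟨ cong (λ l → reverse l ++ reverse Y ++ reverse X) (List.++-identityʳ Z) ⟩
    reverse Z ++ reverse Y ++ reverse X      ∎)
    where open ≡-Reasoning

  reverse₅ : ∀ V W X Y Z → reverse Z ++ reverse Y ++ reverse X ++ reverse W ++ reverse V ≡
                           reverse (V ++ W ++ X ++ Y ++ Z ++ [])
  reverse₅ V W X Y Z = sym (begin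
    reverse (V ++ W ++ X ++ Y ++ Z ++ [])    ≡⟨ List.reverse-++ V _ ⟩
    reverse (W ++ X ++ Y ++ Z ++ []) ++ reverse V
      ≡⟨ cong (_++ reverse V) (List.reverse-++ W _) ⟩
    (reverse (X ++ Y ++ Z ++ []) ++ reverse W) ++ reverse V
      ≡⟨ List.++-assoc (reverse (X ++ Y ++ Z ++ [])) _ _ ⟩
    reverse (X ++ Y ++ Z ++ []) ++ reverse W ++ reverse V
      ≡⟨ cong (_++ reverse W ++ reverse V) (sym (reverse₃ X Y Z)) ⟩
    (reverse Z ++ reverse Y ++ reverse X) ++ reverse W ++ reverse V
      ≡⟨ List.++-assoc (reverse Z) _ _ ⟩
    reverse Z ++ (reverse Y ++ reverse X) ++ reverse W ++ reverse V
      ≡⟨ cong (reverse Z ++_) (List.++-assoc (reverse Y) _ _) ⟩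
    reverse Z ++ reverse Y ++ reverse X ++ reverse W ++ reverse V ∎)
    where open ≡-Reasoning

  unblocked : LiftType → List Square
  unblocked 𝚏 = if isEven i then bwd 5 ++ bwd 4 ++ bwd 3 else fwd 0
  unblocked 𝚐 = if isEven i then fwd 0 else bwd 5 ++ bwd 4 ++ bwd 3
  unblocked 𝚑 = if isEven i then bwd 6 ++ bwd 5 ++ bwd 4 ++ bwd 3 ++ bwd 2
                             else fwd 7 ++ fwd 0 ++ fwd 1

  eq : ∀ x → unblocked x ≡ block x a i
  eq 𝚏 with isEven i
  ... | true  = reverse₃ (fwd 3) (fwd 4) (fwd 5)
  ... | false = sym (List.++-identityʳ _)
  eq 𝚐 with isEven i
  ... | true  = sym (List.++-identityʳ _)
  ... | false = reverse₃ (fwd 3) (fwd 4) (fwd 5)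
  eq 𝚑 with isEven i
  ... | true  = reverse₅ (fwd 2) (fwd 3) (fwd 4) (fwd 5) (fwd 6)
  ... | false = cong (fwd 7 ++_)
    (cong₂ _++_ (cong a (sym (turn-8 i 0)))
                (trans (cong a (sym (turn-8 i 1))) (sym (List.++-identityʳ (fwd 9)))))

  helper : ∀ x → liftPaths x F a i ≡ map (_⊕ shift x F i) (block x a i)
  helper 𝚏 = cong (map (_⊕ shift 𝚏 F i)) (eq 𝚏)
  helper 𝚐 = cong (map (_⊕ shift 𝚐 F i)) (eq 𝚐)
  helper 𝚑 = cong (map (_⊕ shift 𝚑 F i)) (eq 𝚑)

-- The proportions of the enlarged frame as linear forms in those of the frame.
enlargement : LiftType → Matrix
enlargement 𝚏 = (+ 1 , + 0) , (+ 2 , + 1)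
enlargement 𝚐 = (+ 0 , + 1) , (- + 1 , + 2)
enlargement 𝚑 = (+ 0 , + 1) , (+ 1 , + 2)

-- The multiple of the unit vector of direction i by which a lift shifts, as a
-- linear form in the proportions of the frame.
shiftForm : LiftType → Direction → Square
shiftForm 𝚏 i = if isEven i then (+ 1 , + 1) else (+ 1 , + 0)
shiftForm 𝚐 i = if isEven i then (- + 1 , + 1) else (+ 0 , + 1)
shiftForm 𝚑 i = if isEven i then (+ 1 , + 1) else (+ 0 , + 1)

-- The matrix taking the proportions (m , n) to the shift of direction i. At the
-- proportions of M it also gives the center of the shell subboard of
-- direction i in the frame enlarge o M.
shiftMatrix : LiftType → Direction → Matrix
shiftMatrix x i = proj₁ (unit i) ⊛ shiftForm x i , proj₂ (unit i) ⊛ shiftForm x i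

-- The move of the (m , n)-leaper tying the paths of directions i and i + 3; for
-- i = 0 it is (n , - m), and the others are rotations of it and of (n , m).
tieMatrix : Direction → Matrix
tieMatrix i = directionMatrix (turn i 7)

-- The lift of formal paths within a frame with proportions P · (r , s).
liftFormal : LiftType → Matrix → (Direction → List Matrix) → Direction → List Matrix
liftFormal x P A i = map (_⊞ shiftMatrix x i ⊠ P) (block x A i)

-- The invariant of formal lifting: the paths A, within a frame with proportions
-- P · (r , s), form a cycle of formal steps when concatenated, and the end of
-- each is tied to the start of the third next one.
record Coherent (P : Matrix) (A : Direction → List Matrix) : Set where
  field
    first last : Direction → Matrix
    walk  : ∀ i → Walk (first i) (A i) (last i)
    cross : ∀ i → Step (last i) (first (turn i 1))
    tie   : ∀ i → last i ≡ first (turn i 3) ⊞ tieMatrix i ⊠ P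

  walk-arc : ∀ i k l → Walk (first (turn i k)) (concatMap A (arc i k l)) (last (turn i (k ℕ.+ l)))
  walk-arc i k zero    =
    subst₂ (Walk (first (turn i k))) (sym (List.++-identityʳ _)) (cong (last ∘ turn i) (sym (ℕ.+-identityʳ k)))
           (walk (turn i k))
  walk-arc i k (suc l) =
    connect (walk (turn i k))
            (subst (Step (last (turn i k)) ∘ first) (turn-suc i k) (cross (turn i k)))
            (subst (Walk (first (turn i (suc k))) (concatMap A (arc i (suc k) l)) ∘ last ∘ turn i) (sym (ℕ.+-suc k l)) (walk-arc i (suc k) l))

-- The directions of the old paths that contain the first and the last square of
-- the path of direction i after a lift. The square in question is the first
-- or the last one of the old path, according to backward x i.
entry exit : LiftType → Direction → Direction
entry x i = turn i (if backward x i then start x i ℕ.+ extent x i else start x i)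
exit  x i = turn i (if backward x i then start x i else start x i ℕ.+ extent x i)

-- The direction whose tie relates the step from the path of direction i to the
-- next one after a lift to an old step.
pivot : LiftType → Direction → Direction
pivot x i = turn (exit x i) (if backward x i then 5 else 6)

backward-1 : ∀ x i → backward x (turn i 1) ≡ not (backward x i)
backward-1 = toWitness {a? = all-lifts? λ x i → _ Bool.≟ _} _

backward-3 : ∀ x i → backward x (turn i 3) ≡ not (backward x i)
backward-3 = toWitness {a? = all-lifts? λ x i → _ Bool.≟ _} _

entry-3 : ∀ x i → entry x (turn i 3) ≡ exit x i
entry-3 = toWitness {a? = all-lifts? λ x i → _ Fin.≟ _} _

entry-1 : ∀ x i → entry x (turn i 1) ≡ turn (pivot x i) (if backward x i then 1 else 0)
entry-1 = toWitness {a? = all-lifts? λ x i → _ Fin.≟ _} _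

exit-pivot : ∀ x i → turn (exit x i) (if backward x i then 0 else 1) ≡ turn (pivot x i) 3
exit-pivot = toWitness {a? = all-lifts? λ x i → _ Fin.≟ _} _

pivot-shift : ∀ x i → tieMatrix (pivot x i) ⊞ shiftMatrix x (turn i 1) ≡ shiftMatrix x i
pivot-shift = toWitness {a? = all-lifts? λ x i → _ ≟⁴ _} _

tie-shift : ∀ x i → shiftMatrix x i ≡ shiftMatrix x (turn i 3) ⊞ tieMatrix i ⊠ enlargement x
tie-shift = toWitness {a? = all-lifts? λ x i → _ ≟⁴ _} _

-- After a lift, the step from one path to the next is a translate of an old
-- step, by pivot-shift and the tie at the pivot. The new ties hold by
-- tie-shift, as the two ends they relate come from the same old square.
liftFormal-coherent : ∀ x {P A} → Coherent P A → Coherent (enlargement x ⊠ P) (liftFormal x P A)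
liftFormal-coherent x {P} {A} c = record
  { first = λ i → terminal (not (backward x i)) (entry x i) ⊞ shiftMatrix x i ⊠ P
  ; last  = λ i → terminal (backward x i) (exit x i) ⊞ shiftMatrix x i ⊠ P
  ; walk  = λ i → mapWalk (step-translate (shiftMatrix x i ⊠ P)) (walk-oriented (backward x i) i (start x i) (extent x i))
  ; cross = cross′
  ; tie   = tie′
  }
  where
  open Coherent c
  -- The first or last square of an old path.
  terminal : Bool → Direction → Matrix
  terminal b i = if b then first i else last i

  walk-oriented : ∀ b i k l → Walk (terminal (not b) (turn i (if b then k ℕ.+ l else k)))
                                   (orient b (concatMap A (arc i k l)))
                                   (terminal b (turn i (if b then k else k ℕ.+ l)))
  walk-oriented true  i k l = reverseWalk step-sym (walk-arc i k l)
  walk-oriented false i k l = walk-arc i k l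

  T : Direction → Matrix
  T i = shiftMatrix x i ⊠ P

  pivotal : ∀ i → last (pivot x i) ⊞ T (turn i 1) ≡ first (turn (pivot x i) 3) ⊞ T i
  pivotal i = begin
    last (pivot x i) ⊞ T (turn i 1)                ≡⟨ cong (_⊞ T (turn i 1)) (tie (pivot x i)) ⟩
    first (turn (pivot x i) 3) ⊞ tieMatrix (pivot x i) ⊠ P ⊞ T (turn i 1)
      ≡⟨ ⊞-assoc (first (turn (pivot x i) 3)) (tieMatrix (pivot x i) ⊠ P) (T (turn i 1)) ⟩
    first (turn (pivot x i) 3) ⊞ (tieMatrix (pivot x i) ⊠ P ⊞ T (turn i 1))
      ≡⟨ cong (first (turn (pivot x i) 3) ⊞_) (begin
           tieMatrix (pivot x i) ⊠ P ⊞ T (turn i 1)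
             ≡⟨ sym (⊠-distribʳ-⊞ P (tieMatrix (pivot x i)) (shiftMatrix x (turn i 1))) ⟩
           (tieMatrix (pivot x i) ⊞ shiftMatrix x (turn i 1)) ⊠ P
             ≡⟨ cong (_⊠ P) (pivot-shift x i) ⟩
           T i ∎) ⟩
    first (turn (pivot x i) 3) ⊞ T i               ∎
    where open ≡-Reasoning

  step-terminal : ∀ b {b′ j k l} S S′ → b′ ≡ b → k ≡ turn l (if b then 1 else 0) →
                  turn j (if b then 0 else 1) ≡ turn l 3 →
                  last l ⊞ S′ ≡ first (turn l 3) ⊞ S →
                  Step (terminal b j ⊞ S) (terminal b′ k ⊞ S′)
  step-terminal true {j = j} {l = l} S S′ refl refl exit≡ pivotal≡ =
    subst (λ B → Step B (first (turn l 1) ⊞ S′))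
          (trans pivotal≡ (cong (λ j → first j ⊞ S) (trans (sym exit≡) (turn-0 j))))
          (step-translate S′ (cross l))
  step-terminal false {j = j} {l = l} S S′ refl refl exit≡ pivotal≡ =
    subst (Step (last j ⊞ S))
          (trans (cong (λ j → first j ⊞ S) exit≡)
            (trans (sym pivotal≡) (cong (λ j → last j ⊞ S′) (sym (turn-0 l)))))
          (step-translate S (cross j))

  cross′ : ∀ i → Step (terminal (backward x i) (exit x i) ⊞ T i)
                      (terminal (not (backward x (turn i 1))) (entry x (turn i 1)) ⊞ T (turn i 1))
  cross′ i = step-terminal (backward x i) (T i) (T (turn i 1))
    (trans (cong not (backward-1 x i)) (Bool.not-involutive (backward x i)))
    (entry-1 x i) (exit-pivot x i) (pivotal i)

  tie′ : ∀ i → terminal (backward x i) (exit x i) ⊞ T i ≡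
               terminal (not (backward x (turn i 3))) (entry x (turn i 3)) ⊞ T (turn i 3) ⊞
               tieMatrix i ⊠ (enlargement x ⊠ P)
  tie′ i = begin
    X ⊞ T i                             ≡⟨ cong (λ Q → X ⊞ Q ⊠ P) (tie-shift x i) ⟩
    X ⊞ (shiftMatrix x (turn i 3) ⊞ tieMatrix i ⊠ enlargement x) ⊠ P
      ≡⟨ cong (X ⊞_) (⊠-distribʳ-⊞ P (shiftMatrix x (turn i 3)) (tieMatrix i ⊠ enlargement x)) ⟩
    X ⊞ (T (turn i 3) ⊞ tieMatrix i ⊠ enlargement x ⊠ P)
      ≡⟨ cong (λ Q → X ⊞ (T (turn i 3) ⊞ Q)) (⊠-assoc (tieMatrix i) (enlargement x) P) ⟩
    X ⊞ (T (turn i 3) ⊞ tieMatrix i ⊠ (enlargement x ⊠ P))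
      ≡⟨ sym (⊞-assoc X (T (turn i 3)) (tieMatrix i ⊠ (enlargement x ⊠ P))) ⟩
    X ⊞ T (turn i 3) ⊞ tieMatrix i ⊠ (enlargement x ⊠ P)
      ≡⟨ cong (λ Q → Q ⊞ T (turn i 3) ⊞ tieMatrix i ⊠ (enlargement x ⊠ P)) (cong₂ terminal
           (sym (trans (cong not (backward-3 x i)) (Bool.not-involutive (backward x i))))
           (sym (entry-3 x i))) ⟩
    terminal (not (backward x (turn i 3))) (entry x (turn i 3)) ⊞ T (turn i 3) ⊞
      tieMatrix i ⊠ (enlargement x ⊠ P) ∎
    where
    open ≡-Reasoning
    X = terminal (backward x i) (exit x i)

-- The formal squares of a shell cycle: for o = 𝚐 and o = 𝚑, the centers of the
-- shell subboards.
shellFormal : LiftType → Direction → List Matrix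
shellFormal o i = [ shiftMatrix o i ]

shellFormal-coherent : ∀ o → Coherent (enlargement o) (shellFormal o)
shellFormal-coherent o = record
  { first = shiftMatrix o
  ; last  = shiftMatrix o
  ; walk  = λ i → stop (shiftMatrix o i)
  ; cross = λ i → uncurry step (adjacent o i)
  ; tie   = tie-shift o
  }
  where
  adjacent : ∀ o i → ∃ λ d → shiftMatrix o (turn i 1) ≡ shiftMatrix o i ⊞ directionMatrix d
  adjacent = toWitness {a? = all-lifts? λ o i → Fin.any? λ d → _ ≟⁴ _} _

-- The proportions of enlarge* e (enlarge o M) as linear forms in those of M.
formalFrame : Descent → LiftType → Matrix
formalFrame []      o = enlargement o
formalFrame (x ∷ e) o = enlargement x ⊠ formalFrame e o

formalPaths : Descent → LiftType → Direction → List Matrix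
formalPaths []      o = shellFormal o
formalPaths (x ∷ e) o = liftFormal x (formalFrame e o) (formalPaths e o)

formal-coherent : ∀ e o → Coherent (formalFrame e o) (formalPaths e o)
formal-coherent []      o = shellFormal-coherent o
formal-coherent (x ∷ e) o = liftFormal-coherent x (formal-coherent e o)

-- The formal cycle realized by every canonical second leaper cycle of descent e
-- and origin o.
formalCycle : Descent → LiftType → List Matrix
formalCycle e o = concatMap (formalPaths e o) (arc 0F 0 7)

formalCycle-steps : ∀ e o → All (uncurry Step) (steps (formalCycle e o))
formalCycle-steps e o = closed (walk-arc 0F 0 7) (cross 7F)
  where open Coherent (formal-coherent e o)

-- Evaluation of formal squares

-- The proportions of a frame or leaper as a vector.
vector : Frame → Square
vector (m , n) = + m , + n

vector-enlarge : ∀ x {m n} → m ≤ n → vector (enlarge x (m , n)) ≡ enlargement x · vector (m , n)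
vector-enlarge 𝚏 {m} {n} _ = cong₂ _,_ (lemma₁ (+ m) (+ n))
  (trans (cong (ℤ._+ + n) (ℤ.pos-* 2 m)) (lemma₂ (+ m) (+ n)))
  where
  lemma₁ : ∀ x y → x ≡ + 1 ℤ.* x ℤ.+ + 0 ℤ.* y
  lemma₁ = solve-∀
  lemma₂ : ∀ x y → + 2 ℤ.* x ℤ.+ y ≡ + 2 ℤ.* x ℤ.+ + 1 ℤ.* y
  lemma₂ = solve-∀
vector-enlarge 𝚐 {m} {n} m≤n = cong₂ _,_ (lemma₁ (+ m) (+ n))
  (trans (sym (ℤ.⊖-≥ (ℕ.≤-trans m≤n (ℕ.m≤m+n n _))))
    (trans (sym (ℤ.m-n≡m⊖n (2 ℕ.* n) m))
      (trans (cong (ℤ._- + m) (ℤ.pos-* 2 n)) (lemma₂ (+ m) (+ n)))))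
  where
  lemma₁ : ∀ x y → y ≡ + 0 ℤ.* x ℤ.+ + 1 ℤ.* y
  lemma₁ = solve-∀
  lemma₂ : ∀ x y → + 2 ℤ.* y ℤ.- x ≡ - + 1 ℤ.* x ℤ.+ + 2 ℤ.* y
  lemma₂ = solve-∀
vector-enlarge 𝚑 {m} {n} _ = cong₂ _,_ (lemma₁ (+ m) (+ n))
  (trans (cong (ℤ._+_ (+ m)) (ℤ.pos-* 2 n)) (lemma₂ (+ m) (+ n)))
  where
  lemma₁ : ∀ x y → y ≡ + 0 ℤ.* x ℤ.+ + 1 ℤ.* y
  lemma₁ = solve-∀
  lemma₂ : ∀ x y → x ℤ.+ + 2 ℤ.* y ≡ + 1 ℤ.* x ℤ.+ + 2 ℤ.* y
  lemma₂ = solve-∀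

difference-∙ : ∀ m n → + n ℤ.- + m ≡ (-1ℤ , 1ℤ) ∙ (+ m , + n)
difference-∙ m n = lemma (+ m) (+ n)
  where
  lemma : ∀ x y → y ℤ.- x ≡ -1ℤ ℤ.* x ℤ.+ 1ℤ ℤ.* y
  lemma = solve-∀

sum-∙ : ∀ m n → + n ℤ.+ + m ≡ (1ℤ , 1ℤ) ∙ (+ m , + n)
sum-∙ m n = lemma (+ m) (+ n)
  where
  lemma : ∀ x y → y ℤ.+ x ≡ 1ℤ ℤ.* x ℤ.+ 1ℤ ℤ.* y
  lemma = solve-∀

shift-shiftMatrix : ∀ x F i → shift x F i ≡ shiftMatrix x i · vector F
shift-shiftMatrix x (m , n) i = trans (shifted x) (outer (shiftForm x i) (unit i) (+ m , + n))
  where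
  outer : ∀ f u v → (f ∙ v) ⊛ u ≡ (proj₁ u ⊛ f , proj₂ u ⊛ f) · v
  outer (a , b) (u , w) (x , y) = cong₂ _,_ (lemma a b u x y) (lemma a b w x y)
    where
    lemma : ∀ a b u x y → (a ℤ.* x ℤ.+ b ℤ.* y) ℤ.* u ≡ (u ℤ.* a) ℤ.* x ℤ.+ (u ℤ.* b) ℤ.* y
    lemma = solve-∀

  sum : + m ℤ.+ + n ≡ (+ 1 , + 1) ∙ (+ m , + n)
  sum = trans (ℤ.+-comm (+ m) (+ n)) (sum-∙ m n)

  first-∙ : ∀ x y → x ≡ + 1 ℤ.* x ℤ.+ + 0 ℤ.* y
  first-∙ = solve-∀

  second-∙ : ∀ x y → y ≡ + 0 ℤ.* x ℤ.+ + 1 ℤ.* y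
  second-∙ = solve-∀

  multiple : LiftType → ℤ
  multiple 𝚏 = if isEven i then + m ℤ.+ + n else + m
  multiple 𝚐 = if isEven i then + n ℤ.- + m else + n
  multiple 𝚑 = if isEven i then + m ℤ.+ + n else + n

  coefficient : ∀ x → multiple x ≡ shiftForm x i ∙ (+ m , + n)
  coefficient 𝚏 with isEven i
  ... | true  = sum
  ... | false = first-∙ (+ m) (+ n)
  coefficient 𝚐 with isEven i
  ... | true  = difference-∙ m n
  ... | false = second-∙ (+ m) (+ n)
  coefficient 𝚑 with isEven i
  ... | true  = sum
  ... | false = second-∙ (+ m) (+ n)

  shifted : ∀ x → shift x (m , n) i ≡ (shiftForm x i ∙ (+ m , + n)) ⊛ unit i
  shifted 𝚏 = cong (_⊛ unit i) (coefficient 𝚏)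
  shifted 𝚐 = cong (_⊛ unit i) (coefficient 𝚐)
  shifted 𝚑 = cong (_⊛ unit i) (coefficient 𝚑)

-- The weak form of m < n that makes linear forms comparable and truncated
-- subtraction in the enlargement of type 𝚐 exact.
Proper : Frame → Set
Proper (m , n) = m ≤ n

enlarge-proper : ∀ x {F} → Proper F → Proper (enlarge x F)
enlarge-proper 𝚏 {m , n} m≤n = ℕ.≤-trans m≤n (ℕ.m≤n+m n (2 ℕ.* m))
enlarge-proper 𝚐 {m , n} m≤n =
  ℕ.≤-trans (ℕ.≤-reflexive (sym (ℕ.m+n∸n≡m n m)))
            (ℕ.∸-monoˡ-≤ m (ℕ.+-monoʳ-≤ n (ℕ.≤-trans m≤n (ℕ.m≤m+n n 0))))
enlarge-proper 𝚑 {m , n} m≤n = ℕ.≤-trans (ℕ.m≤m+n n _) (ℕ.m≤n+m (2 ℕ.* n) m)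

enlarge*-proper : ∀ e {F} → Proper F → Proper (enlarge* e F)
enlarge*-proper []      = λ p → p
enlarge*-proper (x ∷ e) = enlarge-proper x ∘ enlarge*-proper e

formalFrame-vector : ∀ e o {F} → Proper F →
                     formalFrame e o · vector F ≡ vector (enlarge* e (enlarge o F))
formalFrame-vector []      o p = sym (vector-enlarge o p)
formalFrame-vector (x ∷ e) o {F} p = begin
  (enlargement x ⊠ formalFrame e o) · vector F     ≡⟨ ·-⊠ (enlargement x) (formalFrame e o) (vector F) ⟩
  enlargement x · (formalFrame e o · vector F)     ≡⟨ cong (enlargement x ·_) (formalFrame-vector e o p) ⟩
  enlargement x · vector (enlarge* e (enlarge o F)) ≡⟨ sym (vector-enlarge x (enlarge*-proper e (enlarge-proper o p))) ⟩
  vector (enlarge* (x ∷ e) (enlarge o F))          ∎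
  where open ≡-Reasoning

-- The square for which a formal square stands.
at : Square → Square → Matrix → Square
at c v A = c ⊕ A · v

at-⊞ : ∀ c v A B → at c v (A ⊞ B) ≡ at c v A ⊕ B · v
at-⊞ c v A B = trans (cong (c ⊕_) (·-distribʳ-⊞ v A B)) (sym (⊕-assoc c (A · v) (B · v)))

map-block : ∀ {A B : Set} (f : A → B) x a i → block x (map f ∘ a) i ≡ map f (block x a i)
map-block f x a i with backward x i
... | true  = trans (cong reverse (sym (List.map-concatMap f a (sources x i)))) (sym (List.reverse-map f (concatMap a (sources x i))))
... | false = sym (List.map-concatMap f a (sources x i))

block-cong : ∀ {A : Set} x {a b : Direction → List A} → (∀ i → a i ≡ b i) → ∀ i → block x a i ≡ block x b i
block-cong x a≗b i = cong (orient (backward x i)) (List.concatMap-cong a≗b (sources x i))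

-- Lifting commutes with the evaluation of formal squares.
liftPaths-at : ∀ x F P c v {a : Paths} {A : Direction → List Matrix} → P · v ≡ vector F → (∀ i → a i ≡ map (at c v) (A i)) →
               ∀ i → liftPaths x F a i ≡ map (at c v) (liftFormal x P A i)
liftPaths-at x F P c v {a} {A} Pv≡F a≗A i = begin
  liftPaths x F a i                                     ≡⟨ liftPaths-block x F a i ⟩
  map (_⊕ shift x F i) (block x a i)                    ≡⟨ cong (map _) (trans (block-cong x a≗A i) (map-block (at c v) x A i)) ⟩
  map (_⊕ shift x F i) (map (at c v) (block x A i))     ≡⟨ sym (List.map-∘ (block x A i)) ⟩
  map (λ N → at c v N ⊕ shift x F i) (block x A i)      ≡⟨ List.map-cong translated (block x A i) ⟩
  map (λ N → at c v (N ⊞ shiftMatrix x i ⊠ P)) (block x A i) ≡⟨ List.map-∘ (block x A i) ⟩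
  map (at c v) (liftFormal x P A i)                     ∎
  where
  open ≡-Reasoning
  translated : ∀ N → at c v N ⊕ shift x F i ≡ at c v (N ⊞ shiftMatrix x i ⊠ P)
  translated N = sym (trans (at-⊞ c v N (shiftMatrix x i ⊠ P))
    (cong (at c v N ⊕_) (trans (·-⊠ (shiftMatrix x i) P v)
      (trans (cong (shiftMatrix x i ·_) Pv≡F) (sym (shift-shiftMatrix x F i))))))

liftPaths*-at : ∀ e o {F} c (a : Direction → Square) → Proper F → (∀ i → a i ≡ at c (vector F) (shiftMatrix o i)) →
                ∀ i → liftPaths* e (enlarge o F) (λ i → [ a i ]) i ≡
                      map (at c (vector F)) (formalPaths e o i)
liftPaths*-at []      o c a p a≗ i = cong [_] (a≗ i)
liftPaths*-at (x ∷ e) o {F} c a p a≗ =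
  liftPaths-at x (enlarge* e (enlarge o F)) (formalFrame e o) c (vector F)
               (formalFrame-vector e o p) (liftPaths*-at e o c a p a≗)

join-at : ∀ e o {F} c (a : Direction → Square) → Proper F → (∀ i → a i ≡ at c (vector F) (shiftMatrix o i)) →
          join (liftPaths* e (enlarge o F) (λ i → [ a i ])) ≡ map (at c (vector F)) (formalCycle e o)
join-at e o {F} c a p a≗ = trans (List.concatMap-cong (liftPaths*-at e o c a p a≗) (arc 0F 0 7))
                               (sym (List.map-concatMap (at c (vector F)) (formalPaths e o) (arc 0F 0 7)))

-- Linear forms and intervals

infix 4 _≼_ _≼?_

-- The order on linear forms in (m , n) that is coefficientwise in the basis m,
-- n - m. It implies the inequality of values at every proper frame, so that
-- inequalities between the bounds of regions can be decided by evaluation.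
record _≼_ (f g : Square) : Set where
  constructor dominated
  field
    second : proj₂ f ℤ.≤ proj₂ g
    total  : proj₁ f ℤ.+ proj₂ f ℤ.≤ proj₁ g ℤ.+ proj₂ g

_≼?_ : Decidable _≼_
f ≼? g = map′ (uncurry dominated) (λ { (dominated b t) → b , t })
              ((proj₂ f ℤ.≤? proj₂ g) ×-dec (proj₁ f ℤ.+ proj₂ f ℤ.≤? proj₁ g ℤ.+ proj₂ g))

≼-∙ : ∀ {F} → Proper F → ∀ {f g} → f ≼ g → f ∙ vector F ℤ.≤ g ∙ vector F
≼-∙ {m , n} m≤n {a , b} {a′ , b′} (dominated b≤b′ a+b≤a′+b′) =
  subst₂ ℤ._≤_ (eq a b) (eq a′ b′)
    (ℤ.+-mono-≤ (ℤ.*-monoʳ-≤-nonNeg (+ m) a+b≤a′+b′) (ℤ.*-monoʳ-≤-nonNeg (+ (n ℕ.∸ m)) b≤b′))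
  where
  lemma : ∀ a b x y → (a ℤ.+ b) ℤ.* x ℤ.+ b ℤ.* (y ℤ.- x) ≡ a ℤ.* x ℤ.+ b ℤ.* y
  lemma = solve-∀
  eq : ∀ a b → (a ℤ.+ b) ℤ.* + m ℤ.+ b ℤ.* + (n ℕ.∸ m) ≡ a ℤ.* + m ℤ.+ b ℤ.* + n
  eq a b = trans (cong (λ z → (a ℤ.+ b) ℤ.* + m ℤ.+ b ℤ.* z)
                       (trans (sym (ℤ.⊖-≥ m≤n)) (sym (ℤ.m-n≡m⊖n n m))))
                 (lemma a b (+ m) (+ n))

-- The bounds of twice a coordinate, as linear forms.
Interval : Set
Interval = Square × Square

-- The doubled coordinate 2 x lies strictly between the values at v of the bounds.
record Inside (v : Square) (I : Interval) (x : ℤ) : Set where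
  constructor inside
  field
    below : proj₁ I ∙ v ℤ.< + 2 ℤ.* x
    above : + 2 ℤ.* x ℤ.< proj₂ I ∙ v

open Inside

negate : Interval → Interval
negate (l , u) = -1ℤ ⊛ u , -1ℤ ⊛ l

neg-∙ : ∀ f v → (-1ℤ ⊛ f) ∙ v ≡ - (f ∙ v)
neg-∙ (a , b) (x , y) = lemma a b x y
  where
  lemma : ∀ a b x y → (-1ℤ ℤ.* a) ℤ.* x ℤ.+ (-1ℤ ℤ.* b) ℤ.* y ≡ - (a ℤ.* x ℤ.+ b ℤ.* y)
  lemma = solve-∀

neg-involution : ∀ x → - (+ 2 ℤ.* - x) ≡ + 2 ℤ.* x
neg-involution = solve-∀

inside-negate : ∀ v I {x} → Inside v I (- x) → Inside v (negate I) x
inside-negate v (l , u) {x} (inside l<-x -x<u) = inside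
  (subst₂ ℤ._<_ (sym (neg-∙ u v)) (neg-involution x) (ℤ.neg-mono-< -x<u))
  (subst₂ ℤ._<_ (neg-involution x) (sym (neg-∙ l v)) (ℤ.neg-mono-< l<-x))

-- The intervals of the abscissa over the eight directions, for the images of an
-- E box and an NE box under rotations. The E box has abscissas in the first
-- interval and ordinates between - h and h; the NE box is the square of the
-- second interval.
profile : (side corner : Interval) (half : Square) → Direction → Interval
profile s c h 0F = s
profile s c h 1F = c
profile s c h 2F = -1ℤ ⊛ h , h
profile s c h 3F = negate c
profile s c h 4F = negate s
profile s c h 5F = negate c
profile s c h 6F = -1ℤ ⊛ h , h
profile s c h 7F = c

-- The ordinate of a point in direction i behaves as the abscissa of its
-- clockwise rotation, which has direction turn i 6.
InRegion : Square → (Direction → Interval) → Direction → Square → Set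
InRegion v I i (x , y) = Inside v (I i) x × Inside v (I (turn i 6)) y

-- Only this implication is needed: regions are decomposed by coordinates once,
-- and all further reasoning is about intervals.
rotations-inRegion : ∀ v s₀ s₁ c₀ c₁ h i a →
  rotations (Box (s₀ ∙ v) (s₁ ∙ v) (- (h ∙ v)) (h ∙ v)) (Box (c₀ ∙ v) (c₁ ∙ v) (c₀ ∙ v) (c₁ ∙ v)) i a →
  InRegion v (profile (s₀ , s₁) (c₀ , c₁) h) i a
rotations-inRegion v s₀ s₁ c₀ c₁ h = region
  where
  s c : Interval
  s = s₀ , s₁
  c = c₀ , c₁

  Central : ℤ → Set
  Central x = - (h ∙ v) ℤ.< + 2 ℤ.* x × + 2 ℤ.* x ℤ.< h ∙ v

  central : ∀ {x} → Central x → Inside v (-1ℤ ⊛ h , h) x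
  central {x} (l , u) = inside (subst (ℤ._< + 2 ℤ.* x) (sym (neg-∙ h v)) l) u

  central-neg : ∀ {x} → Central (- x) → Inside v (-1ℤ ⊛ h , h) x
  central-neg {x} (l , u) = inside
    (subst₂ ℤ._<_ (sym (neg-∙ h v)) (neg-involution x) (ℤ.neg-mono-< u))
    (subst₂ ℤ._<_ (neg-involution x) (ℤ.neg-involutive (h ∙ v)) (ℤ.neg-mono-< l))

  undo : ∀ I {x} → Inside v I (- (- x)) → Inside v I x
  undo I {x} = subst (Inside v I) (ℤ.neg-involutive x)

  box : ∀ I {x} → proj₁ I ∙ v ℤ.< + 2 ℤ.* x × + 2 ℤ.* x ℤ.< proj₂ I ∙ v → Inside v I x
  box I (l , u) = inside l u

  region : ∀ i a → rotations (Box (s₀ ∙ v) (s₁ ∙ v) (- (h ∙ v)) (h ∙ v))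
                             (Box (c₀ ∙ v) (c₁ ∙ v) (c₀ ∙ v) (c₁ ∙ v)) i a →
           InRegion v (profile s c h) i a
  region 0F a (p , q) = box s p , central q
  region 1F a (p , q) = box c p , box c q
  region 2F a (p , q) = central-neg q , box s p
  region 3F a (p , q) = inside-negate v c (box c q) , box c p
  region 4F a (p , q) = inside-negate v s (box s p) , central-neg q
  region 5F a (p , q) = inside-negate v c (box c p) , inside-negate v c (box c q)
  region 6F (x , y) (p , q) = central (subst Central (ℤ.neg-involutive x) q) , inside-negate v s (box s p)
  region 7F a (p , q) = undo c (box c q) , inside-negate v c (box c p)

-- The sections have sides between n - m and n + m, in doubled coordinates.
sectionProfile : Direction → Interval
sectionProfile = profile ((-1ℤ , 1ℤ) , (1ℤ , 1ℤ)) ((-1ℤ , 1ℤ) , (1ℤ , 1ℤ)) (-1ℤ , 1ℤ)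

-- The coordinatewise form of Section.
InSection : Frame → Direction → Square → Set
InSection F = InRegion (vector F) sectionProfile

section-inSection : ∀ F i a → Section F i a → InSection F i a
section-inSection F@(m , n) i a p =
  rotations-inRegion (vector F) _ _ _ _ (-1ℤ , 1ℤ) i a
    (subst₂ (λ h b → rotations (Box h b (- h) h) (Box h b h b) i a) (difference-∙ m n) (sum-∙ m n) p)

inSection-unique : ∀ {F} → Proper F → ∀ {i j a} → InSection F i a → InSection F j a → i ≡ j
inSection-unique {F} p {i} {j} {a} (xi , yi) (xj , yj) with
  toWitness {a? = Fin.all? λ i → Fin.all? λ j → (i Fin.≟ j) ⊎-dec
    (apart? (sectionProfile i) (sectionProfile j) ⊎-dec
     apart? (sectionProfile (turn i 6)) (sectionProfile (turn j 6)))} _ i j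
  where
  Apart : Interval → Interval → Set
  Apart (l , u) (l′ , u′) = u ≼ l′ ⊎ u′ ≼ l
  apart? : ∀ I J → Dec (Apart I J)
  apart? (l , u) (l′ , u′) = (u ≼? l′) ⊎-dec (u′ ≼? l)
... | inj₁ i≡j = i≡j
... | inj₂ (inj₁ (inj₁ u≼l)) = contradiction (ℤ.<-≤-trans (above xi) (≼-∙ p u≼l)) (ℤ.<-asym (below xj))
... | inj₂ (inj₁ (inj₂ u≼l)) = contradiction (ℤ.<-≤-trans (above xj) (≼-∙ p u≼l)) (ℤ.<-asym (below xi))
... | inj₂ (inj₂ (inj₁ u≼l)) = contradiction (ℤ.<-≤-trans (above yi) (≼-∙ p u≼l)) (ℤ.<-asym (below yj))
... | inj₂ (inj₂ (inj₂ u≼l)) = contradiction (ℤ.<-≤-trans (above yj) (≼-∙ p u≼l)) (ℤ.<-asym (below yi))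

-- The interval I, translated by the form f, lies within the interval J, whose
-- forms refer to the enlarged frame.
Fits : LiftType → Interval → Square → Interval → Set
Fits x (l , u) f (l′ , u′) = l′ ◁ enlargement x ≼ l ⊕ + 2 ⊛ f × u ⊕ + 2 ⊛ f ≼ u′ ◁ enlargement x

fits? : ∀ x I f J → Dec (Fits x I f J)
fits? x (l , u) f (l′ , u′) = (_ ≼? _) ×-dec (_ ≼? _)

inside-fits : ∀ x {F} → Proper F → ∀ {I f J a} → Fits x I f J → Inside (vector F) I a →
              Inside (vector (enlarge x F)) J (a ℤ.+ f ∙ vector F)
inside-fits x {F} p {l , u} {f} {l′ , u′} {a} (l′≼l , u≼u′) (inside l<a a<u) = inside
  (begin-strict
    l′ ∙ vector (enlarge x F)              ≡⟨ enlarged l′ ⟩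
    (l′ ◁ enlargement x) ∙ vector F        ≤⟨ ≼-∙ p l′≼l ⟩
    (l ⊕ + 2 ⊛ f) ∙ vector F               ≡⟨ translated l ⟩
    l ∙ vector F ℤ.+ + 2 ℤ.* (f ∙ vector F)  <⟨ ℤ.+-monoˡ-< _ l<a ⟩
    + 2 ℤ.* a ℤ.+ + 2 ℤ.* (f ∙ vector F)   ≡⟨ sym (ℤ.*-distribˡ-+ (+ 2) a _) ⟩
    + 2 ℤ.* (a ℤ.+ f ∙ vector F)           ∎)
  (begin-strict
    + 2 ℤ.* (a ℤ.+ f ∙ vector F)           ≡⟨ ℤ.*-distribˡ-+ (+ 2) a _ ⟩
    + 2 ℤ.* a ℤ.+ + 2 ℤ.* (f ∙ vector F)   <⟨ ℤ.+-monoˡ-< _ a<u ⟩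
    u ∙ vector F ℤ.+ + 2 ℤ.* (f ∙ vector F)  ≡⟨ sym (translated u) ⟩
    (u ⊕ + 2 ⊛ f) ∙ vector F               ≤⟨ ≼-∙ p u≼u′ ⟩
    (u′ ◁ enlargement x) ∙ vector F        ≡⟨ sym (enlarged u′) ⟩
    u′ ∙ vector (enlarge x F)              ∎)
  where
  open ℤ.≤-Reasoning
  enlarged : ∀ g → g ∙ vector (enlarge x F) ≡ (g ◁ enlargement x) ∙ vector F
  enlarged g = trans (cong (g ∙_) (vector-enlarge x p)) (sym (∙-◁ g (enlargement x) (vector F)))
  translated : ∀ g → (g ⊕ + 2 ⊛ f) ∙ vector F ≡ g ∙ vector F ℤ.+ + 2 ℤ.* (f ∙ vector F)
  translated g = trans (∙-distribʳ-⊕ (vector F) g (+ 2 ⊛ f)) (cong (λ z → g ∙ vector F ℤ.+ z) (double f (vector F)))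
    where
    double : ∀ f v → (+ 2 ⊛ f) ∙ v ≡ + 2 ℤ.* (f ∙ v)
    double (a , b) (x , y) = lemma a b x y
      where
      lemma : ∀ a b x y → (+ 2 ℤ.* a) ℤ.* x ℤ.+ (+ 2 ℤ.* b) ℤ.* y ≡ + 2 ℤ.* (a ℤ.* x ℤ.+ b ℤ.* y)
      lemma = solve-∀

-- The section of direction j, shifted as in direction i, lies within the section
-- of direction i of the enlarged frame.
SectionFits : LiftType → Direction → Direction → Set
SectionFits x i j =
  Fits x (sectionProfile j) (proj₁ (shiftMatrix x i)) (sectionProfile i) ×
  Fits x (sectionProfile (turn j 6)) (proj₂ (shiftMatrix x i)) (sectionProfile (turn i 6))

sectionFits? : ∀ x i j → Dec (SectionFits x i j)
sectionFits? x i j =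
  fits? x (sectionProfile j) (proj₁ (shiftMatrix x i)) (sectionProfile i) ×-dec
  fits? x (sectionProfile (turn j 6)) (proj₂ (shiftMatrix x i)) (sectionProfile (turn i 6))

sectionFits : ∀ x i → All (SectionFits x i) (sources x i)
sectionFits = toWitness {a? = all-lifts? λ x i → All.all? (sectionFits? x i) (sources x i)} _

inSection-shift : ∀ x {F} → Proper F → ∀ {i j a} → SectionFits x i j →
                  InSection F j a → InSection (enlarge x F) i (a ⊕ shift x F i)
inSection-shift x {F} p {i} {j} {a} (fx , fy) (ax , ay) =
  subst (λ b → InSection (enlarge x F) i (a ⊕ b)) (sym (shift-shiftMatrix x F i))
        ( inside-fits x p {sectionProfile j} {proj₁ (shiftMatrix x i)} {sectionProfile i} fx ax
        , inside-fits x p {sectionProfile (turn j 6)} {proj₂ (shiftMatrix x i)} {sectionProfile (turn i 6)} fy ay)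

-- Distinctness of the squares of a lifted cycle

unique-concatMap : ∀ {A B : Set} (a : B → List A) {l} → Unique l → (∀ i → Unique (a i)) →
                   (∀ {i j} → i ≢ j → Disjoint (a i) (a j)) → Unique (concatMap a l)
unique-concatMap a l! a! disjoint =
  Unique.concat⁺ (All.map⁺ (All.universal a! _)) (AllPairs.map⁺ (AllPairs.map disjoint l!))

unique-orient : ∀ {A : Set} b {xs : List A} → Unique xs → Unique (orient b xs)
unique-orient true  {xs} = Permutation.Unique-resp-↭ (setoid _) (↭⇒↭ₛ (↭-sym (↭-reverse xs)))
unique-orient false u = u

all-orient : ∀ {A : Set} {P : A → Set} b {xs : List A} → All P xs → All P (orient b xs)
all-orient true  {xs} = All-resp-↭ (↭-sym (↭-reverse xs))
all-orient false ps = ps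

-- The paths visit distinct squares, each path within its own section.
record Placed (F : Frame) (a : Paths) : Set where
  field
    distinct : ∀ i → Unique (a i)
    placed   : ∀ i → All (InSection F i) (a i)

  disjoint : Proper F → ∀ {i j} → i ≢ j → Disjoint (a i) (a j)
  disjoint p i≢j (x∈i , x∈j) =
    i≢j (inSection-unique p (All.lookup (placed _) x∈i) (All.lookup (placed _) x∈j))

sources-unique : ∀ x i → Unique (sources x i)
sources-unique = toWitness {a? = all-lifts? λ x i → DecUnique.unique? Fin._≟_ (sources x i)} _

liftPaths-placed : ∀ x {F a} → Proper F → Placed F a → Placed (enlarge x F) (liftPaths x F a)
liftPaths-placed x {F} {a} p a-placed = record
  { distinct = λ i → subst Unique (sym (liftPaths-block x F a i))
      (Unique.map⁺ (λ {b} {c} eq → ⊕-cancelʳ (shift x F i) eq)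
        (unique-orient (backward x i)
          (unique-concatMap a (sources-unique x i) distinct (disjoint p))))
  ; placed = λ i → subst (All _) (sym (liftPaths-block x F a i))
      (All.map⁺ (all-orient (backward x i)
        (All.concat⁺ (All.map⁺ (All.map (λ {j} fits → All.map (inSection-shift x p fits) (placed j)) (sectionFits x i))))))
  }
  where
  open Placed a-placed

liftPaths*-placed : ∀ e {F a} → Proper F → Placed F a → Placed (enlarge* e F) (liftPaths* e F a)
liftPaths*-placed []      p a-placed = a-placed
liftPaths*-placed (x ∷ e) p a-placed =
  liftPaths-placed x (enlarge*-proper e p) (liftPaths*-placed e p a-placed)

join-unique : ∀ {F a} → Proper F → Placed F a → Unique (join a)
join-unique p a-placed = unique-concatMap _ (Unique.allFin⁺ 8) distinct (disjoint p)
  where open Placed a-placed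

-- Directions of moves

directionVector : SkewDirection → Square → Square
directionVector 0F (x , y) = y , x
directionVector 1F (x , y) = x , y
directionVector 2F (x , y) = - x , y
directionVector 3F (x , y) = - y , x
directionVector 4F (x , y) = - y , - x
directionVector 5F (x , y) = - x , - y
directionVector 6F (x , y) = x , - y
directionVector 7F (x , y) = y , - x

directionMatrix-· : ∀ d v → directionMatrix d · v ≡ directionVector d v
directionMatrix-· d (x , y) = eq d
  where
  fst⁺ : ∀ x y → + 1 ℤ.* x ℤ.+ + 0 ℤ.* y ≡ x
  fst⁺ = solve-∀
  snd⁺ : ∀ x y → + 0 ℤ.* x ℤ.+ + 1 ℤ.* y ≡ y
  snd⁺ = solve-∀
  fst⁻ : ∀ x y → - + 1 ℤ.* x ℤ.+ + 0 ℤ.* y ≡ - x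
  fst⁻ = solve-∀
  snd⁻ : ∀ x y → + 0 ℤ.* x ℤ.+ - + 1 ℤ.* y ≡ - y
  snd⁻ = solve-∀
  eq : ∀ d → directionMatrix d · (x , y) ≡ directionVector d (x , y)
  eq 0F = cong₂ _,_ (snd⁺ x y) (fst⁺ x y)
  eq 1F = cong₂ _,_ (fst⁺ x y) (snd⁺ x y)
  eq 2F = cong₂ _,_ (fst⁻ x y) (snd⁺ x y)
  eq 3F = cong₂ _,_ (snd⁻ x y) (fst⁺ x y)
  eq 4F = cong₂ _,_ (snd⁻ x y) (fst⁻ x y)
  eq 5F = cong₂ _,_ (fst⁻ x y) (snd⁻ x y)
  eq 6F = cong₂ _,_ (fst⁺ x y) (snd⁻ x y)
  eq 7F = cong₂ _,_ (snd⁺ x y) (fst⁻ x y)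

translation⇒direction : ∀ L {w} → Translation L w → ∃ λ d → w ≡ directionMatrix d · vector L
translation⇒direction (p , q) (s , t , w≡) with explicit s t w≡
  where
  pos : ∀ n → Sign.+ ◃ n ≡ + n
  pos = ℤ.+◃n≡+n
  neg : ∀ n → Sign.- ◃ n ≡ - + n
  neg = ℤ.-◃n≡-n
  explicit : ∀ s t {w} → w ≡ (s ◃ p , t ◃ q) ⊎ w ≡ (s ◃ q , t ◃ p) → ∃ λ d → w ≡ directionVector d (+ p , + q)
  explicit Sign.+ Sign.+ (inj₁ refl) = 1F , cong₂ _,_ (pos p) (pos q)
  explicit Sign.+ Sign.- (inj₁ refl) = 6F , cong₂ _,_ (pos p) (neg q)
  explicit Sign.- Sign.+ (inj₁ refl) = 2F , cong₂ _,_ (neg p) (pos q)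
  explicit Sign.- Sign.- (inj₁ refl) = 5F , cong₂ _,_ (neg p) (neg q)
  explicit Sign.+ Sign.+ (inj₂ refl) = 0F , cong₂ _,_ (pos q) (pos p)
  explicit Sign.+ Sign.- (inj₂ refl) = 7F , cong₂ _,_ (pos q) (neg p)
  explicit Sign.- Sign.+ (inj₂ refl) = 3F , cong₂ _,_ (neg q) (pos p)
  explicit Sign.- Sign.- (inj₂ refl) = 4F , cong₂ _,_ (neg q) (neg p)
... | d , w≡′ = d , trans w≡′ (sym (directionMatrix-· d (vector (p , q))))

direction⇒translation : ∀ L d → Translation L (directionMatrix d · vector L)
direction⇒translation (p , q) d =
  subst (Translation (p , q)) (sym (directionMatrix-· d (+ p , + q))) (translation d)
  where
  pos : ∀ n → + n ≡ Sign.+ ◃ n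
  pos n = sym (ℤ.+◃n≡+n n)
  neg : ∀ n → - + n ≡ Sign.- ◃ n
  neg n = sym (ℤ.-◃n≡-n n)
  translation : ∀ d → Translation (p , q) (directionVector d (+ p , + q))
  translation 0F = Sign.+ , Sign.+ , inj₂ (cong₂ _,_ (pos q) (pos p))
  translation 1F = Sign.+ , Sign.+ , inj₁ (cong₂ _,_ (pos p) (pos q))
  translation 2F = Sign.- , Sign.+ , inj₁ (cong₂ _,_ (neg p) (pos q))
  translation 3F = Sign.- , Sign.+ , inj₂ (cong₂ _,_ (neg q) (pos p))
  translation 4F = Sign.- , Sign.- , inj₂ (cong₂ _,_ (neg q) (neg p))
  translation 5F = Sign.- , Sign.- , inj₁ (cong₂ _,_ (neg p) (neg q))
  translation 6F = Sign.+ , Sign.- , inj₁ (cong₂ _,_ (pos p) (neg q))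
  translation 7F = Sign.+ , Sign.- , inj₂ (cong₂ _,_ (pos q) (neg p))

infix 4 _≺_ _≺?_

-- The strict version of ≼, for frames with 0 < m < n.
_≺_ : Square → Square → Set
(a , b) ≺ (a′ , b′) =
  (b ℤ.< b′ × a ℤ.+ b ℤ.≤ a′ ℤ.+ b′) ⊎ (b ℤ.≤ b′ × a ℤ.+ b ℤ.< a′ ℤ.+ b′)

_≺?_ : Decidable _≺_
(a , b) ≺? (a′ , b′) = ((b ℤ.<? b′) ×-dec (a ℤ.+ b ℤ.≤? a′ ℤ.+ b′)) ⊎-dec
                       ((b ℤ.≤? b′) ×-dec (a ℤ.+ b ℤ.<? a′ ℤ.+ b′))

≺-∙ : ∀ {m n} → m ≢ 0 → m ℕ.< n → ∀ f g → f ≺ g → f ∙ (+ m , + n) ℤ.< g ∙ (+ m , + n)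
≺-∙ {m} {n} m≢0 m<n (a , b) (a′ , b′) f≺g = subst₂ ℤ._<_ (lemma a b (+ m) (+ n)) (lemma a′ b′ (+ m) (+ n)) (strictly f≺g)
  where
  lemma : ∀ a b x y → (a ℤ.+ b) ℤ.* x ℤ.+ b ℤ.* (y ℤ.- x) ≡ a ℤ.* x ℤ.+ b ℤ.* y
  lemma = solve-∀
  n-m>0 : 0ℤ ℤ.< + n ℤ.- + m
  n-m>0 = subst (ℤ._< + n ℤ.- + m) (ℤ.+-inverseʳ (+ m)) (ℤ.+-monoˡ-< (- + m) (ℤ.+<+ m<n))
  instance
    m⁺ : ℤ.Positive (+ m)
    m⁺ = ℤ.positive (ℤ.+<+ (ℕ.n≢0⇒n>0 m≢0))
    n-m⁺ : ℤ.Positive (+ n ℤ.- + m)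
    n-m⁺ = ℤ.positive n-m>0
    n-m⁰ : ℤ.NonNegative (+ n ℤ.- + m)
    n-m⁰ = ℤ.nonNegative (ℤ.<⇒≤ n-m>0)
  strictly : (a , b) ≺ (a′ , b′) → (a ℤ.+ b) ℤ.* + m ℤ.+ b ℤ.* (+ n ℤ.- + m) ℤ.<
                                 (a′ ℤ.+ b′) ℤ.* + m ℤ.+ b′ ℤ.* (+ n ℤ.- + m)
  strictly (inj₁ (b<b′ , s≤s′)) = ℤ.+-mono-≤-< (ℤ.*-monoʳ-≤-nonNeg (+ m) s≤s′) (ℤ.*-monoʳ-<-pos (+ n ℤ.- + m) b<b′)
  strictly (inj₂ (b≤b′ , s<s′)) = ℤ.+-mono-<-≤ (ℤ.*-monoʳ-<-pos (+ m) s<s′) (ℤ.*-monoʳ-≤-nonNeg (+ n ℤ.- + m) b≤b′)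

-- Distinct directions differ in some coordinate by a form of constant sign.
direction-injective : ∀ {m n} → m ≢ 0 → m ℕ.< n → ∀ {c d} →
                      directionMatrix c · (+ m , + n) ≡ directionMatrix d · (+ m , + n) → c ≡ d
direction-injective m≢0 m<n {c} {d} eq with
  toWitness {a? = Fin.all? λ c → Fin.all? λ d → (c Fin.≟ d) ⊎-dec
    (apart? (proj₁ (directionMatrix c)) (proj₁ (directionMatrix d)) ⊎-dec
     apart? (proj₂ (directionMatrix c)) (proj₂ (directionMatrix d)))} _ c d
  where
  apart? : ∀ f g → Dec (f ≺ g ⊎ g ≺ f)
  apart? f g = (f ≺? g) ⊎-dec (g ≺? f)
... | inj₁ c≡d = c≡d
... | inj₂ (inj₁ (inj₁ f≺g)) = contradiction (cong proj₁ eq)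
  (ℤ.<⇒≢ (≺-∙ m≢0 m<n (proj₁ (directionMatrix c)) (proj₁ (directionMatrix d)) f≺g))
... | inj₂ (inj₁ (inj₂ g≺f)) = contradiction (sym (cong proj₁ eq))
  (ℤ.<⇒≢ (≺-∙ m≢0 m<n (proj₁ (directionMatrix d)) (proj₁ (directionMatrix c)) g≺f))
... | inj₂ (inj₂ (inj₁ f≺g)) = contradiction (cong proj₂ eq)
  (ℤ.<⇒≢ (≺-∙ m≢0 m<n (proj₂ (directionMatrix c)) (proj₂ (directionMatrix d)) f≺g))
... | inj₂ (inj₂ (inj₂ g≺f)) = contradiction (sym (cong proj₂ eq))
  (ℤ.<⇒≢ (≺-∙ m≢0 m<n (proj₂ (directionMatrix d)) (proj₂ (directionMatrix c)) g≺f))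

-- Shell cycles

-- The subboards of the shell of the frame enlarge (signLift σ) M: the narrow
-- shell for type 𝚐, the wide one for type 𝚑. The forms refer to that frame.
shellProfile : Sign → Direction → Interval
shellProfile Sign.- = profile ((-1ℤ , 1ℤ) , (- + 3 , + 3)) ((+ 3 , -1ℤ) , (1ℤ , 1ℤ)) (-1ℤ , 1ℤ)
shellProfile Sign.+ = profile ((- + 5 , + 3) , (1ℤ , 1ℤ)) ((-1ℤ , 1ℤ) , (+ 5 , -1ℤ)) (+ 3 , -1ℤ)

-- InShell σ M i a: the square a lies in the subboard of direction i.
InShell : Sign → Frame → Direction → Square → Set
InShell σ M = InRegion (vector (enlarge (signLift σ) M)) (shellProfile σ)

boxes : (s₀ s₁ h c₀ c₁ : ℤ) → Direction → Square → Set
boxes s₀ s₁ h c₀ c₁ = rotations (Box s₀ s₁ (- h) h) (Box c₀ c₁ c₀ c₁)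

boxes-cong : ∀ {s₀ s₁ h c₀ c₁ s₀′ s₁′ h′ c₀′ c₁′} → s₀ ≡ s₀′ → s₁ ≡ s₁′ → h ≡ h′ → c₀ ≡ c₀′ → c₁ ≡ c₁′ →
             ∀ {i a} → boxes s₀ s₁ h c₀ c₁ i a → boxes s₀′ s₁′ h′ c₀′ c₁′ i a
boxes-cong refl refl refl refl refl p = p

narrowShell-inRegion : ∀ F i a → NarrowShell F i a → InRegion (vector F) (shellProfile Sign.-) i a
narrowShell-inRegion (m , n) i a p =
  rotations-inRegion (+ m , + n) _ _ _ _ (-1ℤ , 1ℤ) i a
    (boxes-cong (difference-∙ m n) (far (+ m) (+ n)) (difference-∙ m n) (near (+ m) (+ n)) (sum-∙ m n) {i} {a} p)
  where
  far : ∀ x y → (y ℤ.- x) ℤ.+ + 2 ℤ.* (y ℤ.- x) ≡ - + 3 ℤ.* x ℤ.+ + 3 ℤ.* y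
  far = solve-∀
  near : ∀ x y → (y ℤ.+ x) ℤ.- + 2 ℤ.* (y ℤ.- x) ≡ + 3 ℤ.* x ℤ.+ -1ℤ ℤ.* y
  near = solve-∀

wideShell-inRegion : ∀ F i a → WideShell F i a → InRegion (vector F) (shellProfile Sign.+) i a
wideShell-inRegion (m , n) i a p =
  rotations-inRegion (+ m , + n) _ _ _ _ (+ 3 , -1ℤ) i a
    (boxes-cong (near (+ m) (+ n)) (sum-∙ m n) (side (+ m) (+ n)) (difference-∙ m n) (far (+ m) (+ n)) {i} {a} p)
  where
  side : ∀ x y → + 3 ℤ.* x ℤ.- y ≡ + 3 ℤ.* x ℤ.+ -1ℤ ℤ.* y
  side = solve-∀
  near : ∀ x y → (y ℤ.+ x) ℤ.- + 2 ℤ.* (+ 3 ℤ.* x ℤ.- y) ≡ - + 5 ℤ.* x ℤ.+ + 3 ℤ.* y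
  near = solve-∀
  far : ∀ x y → (y ℤ.- x) ℤ.+ + 2 ℤ.* (+ 3 ℤ.* x ℤ.- y) ≡ + 5 ℤ.* x ℤ.+ -1ℤ ℤ.* y
  far = solve-∀

-- A frame produced by a lift of type 𝚏 has n > 3 m, hence no shell.
shell-origin : ∀ o {r s} → r ≢ 0 → r ℕ.< s → ∀ {a} → Shell (enlarge o (r , s)) a → ∃ λ σ → o ≡ signLift σ
shell-origin 𝚐 _ _ _ = Sign.- , refl
shell-origin 𝚑 _ _ _ = Sign.+ , refl
shell-origin 𝚏 {r} {s} r≢0 r<s (inj₁ (2r+s≤2r , _)) =
  contradiction 2r+s≤2r (ℕ.<⇒≱ (ℕ.m<m+n (2 ℕ.* r) (ℕ.≤-<-trans ℕ.z≤n r<s)))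
shell-origin 𝚏 {r} {s} r≢0 r<s (inj₂ (_ , 2r+s≤3r , _)) =
  contradiction 2r+s≤3r (ℕ.<⇒≱ (ℕ.<-≤-trans (ℕ.+-monoʳ-< r (ℕ.+-monoʳ-< r (subst (ℕ._< s) (sym (ℕ.+-identityʳ r)) r<s)))
    (ℕ.≤-reflexive (rearrange r s))))
  where
  rearrange : ∀ r s → r ℕ.+ (r ℕ.+ s) ≡ 2 ℕ.* r ℕ.+ s
  rearrange = solveℕ-∀

-- Each of the two shells is excluded for the other origin, as r is nonzero.
shell-inShell : ∀ σ {r s} → r ≢ 0 → r ℕ.< s → ∀ {a} → Shell (enlarge (signLift σ) (r , s)) a →
                ∃ λ i → InShell σ (r , s) i a
shell-inShell Sign.- {r} {s} r≢0 r<s (inj₁ (_ , i , p)) = i , narrowShell-inRegion (s , 2 ℕ.* s ℕ.∸ r) i _ p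
shell-inShell Sign.- {r} {s} r≢0 r<s (inj₂ (2s≤2s-r , _)) =
  contradiction 2s≤2s-r (ℕ.<⇒≱ (ℕ.∸-monoʳ-< {2 ℕ.* s} {r} {0} (ℕ.n≢0⇒n>0 r≢0) (ℕ.≤-trans (ℕ.<⇒≤ r<s) (ℕ.m≤m+n s _))))
shell-inShell Sign.+ {r} {s} r≢0 r<s (inj₁ (r+2s≤2s , _)) =
  contradiction r+2s≤2s (ℕ.<⇒≱ (ℕ.m<n+m (2 ℕ.* s) (ℕ.n≢0⇒n>0 r≢0)))
shell-inShell Sign.+ {r} {s} r≢0 r<s (inj₂ (_ , _ , i , p)) = i , wideShell-inRegion (s , r ℕ.+ 2 ℕ.* s) i _ p

all-signs? : {P : Sign → Set} → (∀ σ → Dec (P σ)) → Dec (∀ σ → P σ)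
all-signs? P? = map′ (λ { (p , q) Sign.- → p ; (p , q) Sign.+ → q }) (λ p → p Sign.- , p Sign.+)
                     (P? Sign.- ×-dec P? Sign.+)

-- The interval I of the enlarged frame lies within the interval J of the frame.
Within : LiftType → Interval → Interval → Set
Within x (l , u) (l′ , u′) = l′ ≼ l ◁ enlargement x × u ◁ enlargement x ≼ u′

within? : ∀ x I J → Dec (Within x I J)
within? x (l , u) (l′ , u′) = (_ ≼? _) ×-dec (_ ≼? _)

inside-within : ∀ x {F} → Proper F → ∀ {I J a} → Within x I J → Inside (vector (enlarge x F)) I a → Inside (vector F) J a
inside-within x {F} p {l , u} (l′≼l , u≼u′) (inside l<a a<u) = inside
  (ℤ.≤-<-trans (≼-∙ p l′≼l) (subst (ℤ._< _) (enlarged l) l<a))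
  (ℤ.<-≤-trans (subst (_ ℤ.<_) (enlarged u) a<u) (≼-∙ p u≼u′))
  where
  enlarged : ∀ g → g ∙ vector (enlarge x F) ≡ (g ◁ enlargement x) ∙ vector F
  enlarged g = trans (cong (g ∙_) (vector-enlarge x p)) (sym (∙-◁ g (enlargement x) (vector F)))

-- Doubled coordinates between r - s and s - r: the position of a square relative
-- to the center of its shell subboard, whose side is s - r for both origins.
core : Interval
core = (1ℤ , -1ℤ) , (-1ℤ , 1ℤ)

-- Doubled coordinates are translated by twice the form.
translate : Square → Interval → Interval
translate f (l , u) = f ⊕ f ⊕ l , f ⊕ f ⊕ u

shell-core : ∀ σ i → Within (signLift σ) (shellProfile σ i) (translate (proj₁ (shiftMatrix (signLift σ) i)) core) ×
                     Within (signLift σ) (shellProfile σ (turn i 6)) (translate (proj₂ (shiftMatrix (signLift σ) i)) core)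
shell-core = toWitness {a? = all-signs? λ σ → Fin.all? λ i →
  within? (signLift σ) (shellProfile σ i) (translate (proj₁ (shiftMatrix (signLift σ) i)) core) ×-dec
  within? (signLift σ) (shellProfile σ (turn i 6)) (translate (proj₂ (shiftMatrix (signLift σ) i)) core)} _

-- Both intervals refer to the enlarged frame, but are compared by forms in the
-- original one, in which the condition on the proportions under which a shell
-- exists is automatic.
Contained : LiftType → Interval → Interval → Set
Contained x (l , u) (l′ , u′) = l′ ◁ enlargement x ≼ l ◁ enlargement x × u ◁ enlargement x ≼ u′ ◁ enlargement x

contained? : ∀ x I J → Dec (Contained x I J)
contained? x (l , u) (l′ , u′) = (_ ≼? _) ×-dec (_ ≼? _)

inside-contained : ∀ x {F} → Proper F → ∀ I J {a} → Contained x I J →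
                   Inside (vector (enlarge x F)) I a → Inside (vector (enlarge x F)) J a
inside-contained x {F} p (l , u) (l′ , u′) (l′≼l , u≼u′) (inside l<a a<u) = inside
  (ℤ.≤-<-trans (subst₂ ℤ._≤_ (enlarged l′) (enlarged l) (≼-∙ p l′≼l)) l<a)
  (ℤ.<-≤-trans a<u (subst₂ ℤ._≤_ (enlarged u) (enlarged u′) (≼-∙ p u≼u′)))
  where
  enlarged : ∀ g → (g ◁ enlargement x) ∙ vector F ≡ g ∙ vector (enlarge x F)
  enlarged g = sym (trans (cong (g ∙_) (vector-enlarge x p)) (sym (∙-◁ g (enlargement x) (vector F))))

shell-section : ∀ σ i → Contained (signLift σ) (shellProfile σ i) (sectionProfile i)
shell-section = toWitness {a? = all-signs? λ σ → Fin.all? λ i →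
  contained? (signLift σ) (shellProfile σ i) (sectionProfile i)} _

inShell-inSection : ∀ σ {M} → Proper M → ∀ {i a} → InShell σ M i a → InSection (enlarge (signLift σ) M) i a
inShell-inSection σ p {i} (x , y) =
  inside-contained (signLift σ) p (shellProfile σ i) (sectionProfile i) (shell-section σ i) x ,
  inside-contained (signLift σ) p (shellProfile σ (turn i 6)) (sectionProfile (turn i 6)) (shell-section σ (turn i 6)) y

-- The position of a square relative to the center of its shell subboard.
Central : Square → Square → Set
Central v (x , y) = Inside v core x × Inside v core y

inside-translate : ∀ v f {a} → Inside v (translate f core) (a ℤ.+ f ∙ v) → Inside v core a
inside-translate v f {a} (inside l<a a<u) = inside
  (cancel (+ 2 ℤ.* (f ∙ v)) (subst₂ ℤ._<_ (lower (proj₁ core)) (upper a (f ∙ v)) l<a))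
  (cancel (+ 2 ℤ.* (f ∙ v)) (subst₂ ℤ._<_ (upper a (f ∙ v)) (lower (proj₂ core)) a<u))
  where
  cancel : ∀ k {x y} → k ℤ.+ x ℤ.< k ℤ.+ y → x ℤ.< y
  cancel k {x} {y} p = subst₂ ℤ._<_ (undo k x) (undo k y) (ℤ.+-monoʳ-< (- k) p)
    where
    undo : ∀ k x → - k ℤ.+ (k ℤ.+ x) ≡ x
    undo = solve-∀
  lower : ∀ g → (f ⊕ f ⊕ g) ∙ v ≡ + 2 ℤ.* (f ∙ v) ℤ.+ g ∙ v
  lower g = trans (∙-distribʳ-⊕ v (f ⊕ f) g)
    (cong (ℤ._+ g ∙ v) (trans (∙-distribʳ-⊕ v f f) (double (f ∙ v))))
    where
    double : ∀ x → x ℤ.+ x ≡ + 2 ℤ.* x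
    double = solve-∀
  upper : ∀ a x → + 2 ℤ.* (a ℤ.+ x) ≡ + 2 ℤ.* x ℤ.+ + 2 ℤ.* a
  upper = solve-∀

shell-central : ∀ σ {M} → Proper M → ∀ {i a} → InShell σ M i a →
                ∃ λ c → Central (vector M) c × a ≡ at c (vector M) (shiftMatrix (signLift σ) i)
shell-central σ {M} p {i} {a , b} (x , y) =
  (a ℤ.- f ∙ v , b ℤ.- g ∙ v) ,
  (inside-translate v f (subst (Inside v _) (undo a (f ∙ v)) (inside-within (signLift σ) p (proj₁ (shell-core σ i)) x)) ,
   inside-translate v g (subst (Inside v _) (undo b (g ∙ v)) (inside-within (signLift σ) p (proj₂ (shell-core σ i)) y))) ,
  cong₂ _,_ (undo a (f ∙ v)) (undo b (g ∙ v))
  where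
  v = vector M
  f = proj₁ (shiftMatrix (signLift σ) i)
  g = proj₂ (shiftMatrix (signLift σ) i)
  undo : ∀ a x → a ≡ (a ℤ.- x) ℤ.+ x
  undo = solve-∀

-- The value of the form is at least s - r in absolute value, and hence not the
-- difference of two coordinates within the core.
Far : Square → Set
Far f = proj₂ core ≼ f ⊎ proj₂ core ≼ -1ℤ ⊛ f

far? : ∀ f → Dec (Far f)
far? f = (_ ≼? _) ⊎-dec (_ ≼? _)

far-apart : ∀ {F} → Proper F → ∀ {f a} → Far f → Inside (vector F) core a →
            ¬ Inside (vector F) core (a ℤ.+ f ∙ vector F)
far-apart {F} p {f} {a} (inj₁ d≼f) (inside l<a _) (inside _ a+f<d) = ℤ.<-irrefl refl (begin-strict
  d                              ≡⟨ lemma₁ d ⟩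
  - d ℤ.+ + 2 ℤ.* d              <⟨ ℤ.+-monoˡ-< (+ 2 ℤ.* d) (subst (ℤ._< + 2 ℤ.* a) (neg-∙ (-1ℤ , 1ℤ) (vector F)) l<a) ⟩
  + 2 ℤ.* a ℤ.+ + 2 ℤ.* d        ≤⟨ ℤ.+-monoʳ-≤ (+ 2 ℤ.* a) (ℤ.*-monoˡ-≤-nonNeg (+ 2) (≼-∙ p d≼f)) ⟩
  + 2 ℤ.* a ℤ.+ + 2 ℤ.* (f ∙ vector F) ≡⟨ sym (ℤ.*-distribˡ-+ (+ 2) a (f ∙ vector F)) ⟩
  + 2 ℤ.* (a ℤ.+ f ∙ vector F)   <⟨ a+f<d ⟩
  d                              ∎)
  where
  open ℤ.≤-Reasoning
  d = (-1ℤ , 1ℤ) ∙ vector F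
  lemma₁ : ∀ d → d ≡ - d ℤ.+ + 2 ℤ.* d
  lemma₁ = solve-∀
far-apart {F} p {f} {a} (inj₂ d≼-f) a-core a+f-core =
  far-apart p {f = -1ℤ ⊛ f} {a ℤ.+ f ∙ vector F} (inj₁ d≼-f) a+f-core
    (subst (Inside (vector F) core) (trans (undo a (f ∙ vector F))
      (cong (λ z → a ℤ.+ f ∙ vector F ℤ.+ z) (sym (neg-∙ f (vector F))))) a-core)
  where
  undo : ∀ a x → a ≡ (a ℤ.+ x) ℤ.+ - x
  undo = solve-∀

-- By how much a move of direction d from the subboard of direction i to that of
-- direction j changes the position relative to the center. The center of
-- direction turn j 4 is the negative of that of direction j.
shellMove : Sign → Direction → Direction → SkewDirection → Matrix
shellMove σ i j d = shiftMatrix o i ⊞ directionMatrix d ⊠ enlargement o ⊞ shiftMatrix o (turn j 4)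
  where o = signLift σ

shellMove-shift : ∀ σ i j d → shellMove σ i j d ⊞ shiftMatrix (signLift σ) j ≡
                  shiftMatrix (signLift σ) i ⊞ directionMatrix d ⊠ enlargement (signLift σ)
shellMove-shift σ i j d = trans (⊞-assoc A (shiftMatrix o (turn j 4)) (shiftMatrix o j))
  (trans (cong (A ⊞_) (toWitness {a? = all-lifts? λ x j → shiftMatrix x (turn j 4) ⊞ shiftMatrix x j ≟⁴ O} _ o j)) (⊞-identityʳ A))
  where
  o = signLift σ
  A = shiftMatrix o i ⊞ directionMatrix d ⊠ enlargement o

-- Of all conceivable moves between subboards, those that do not preserve the
-- relative position change some coordinate by too much. There are 1024 cases.
shellMove-trivial : ∀ σ i j d → (Far (proj₁ (shellMove σ i j d)) ⊎ Far (proj₂ (shellMove σ i j d))) ⊎ shellMove σ i j d ≡ O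
shellMove-trivial = toWitness {a? = all-signs? λ σ → Fin.all? λ i → Fin.all? λ j → Fin.all? λ d →
  (far? (proj₁ (shellMove σ i j d)) ⊎-dec far? (proj₂ (shellMove σ i j d))) ⊎-dec (shellMove σ i j d ≟⁴ O)} _

central-displacement : ∀ {F} → Proper F → ∀ {c c′} N → Central (vector F) c → Central (vector F) c′ →
                       c′ ≡ c ⊕ N · vector F → (Far (proj₁ N) ⊎ Far (proj₂ N)) ⊎ N ≡ O → c′ ≡ c
central-displacement {F} p N (cx , _) (cx′ , _) eq (inj₁ (inj₁ far)) =
  ⊥-elim (far-apart p far cx (subst (Inside (vector F) core) (cong proj₁ eq) cx′))
central-displacement {F} p N (_ , cy) (_ , cy′) eq (inj₁ (inj₂ far)) =
  ⊥-elim (far-apart p far cy (subst (Inside (vector F) core) (cong proj₂ eq) cy′))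
central-displacement {F} p {a , b} _ _ _ eq (inj₂ refl) =
  trans eq (cong₂ _,_ (zero-∙ a (proj₁ (vector F)) (proj₂ (vector F))) (zero-∙ b (proj₁ (vector F)) (proj₂ (vector F))))
  where
  zero-∙ : ∀ a x y → a ℤ.+ (0ℤ ℤ.* x ℤ.+ 0ℤ ℤ.* y) ≡ a
  zero-∙ = solve-∀

at-displaced : ∀ x {F} → Proper F → ∀ {c c′} A B N d →
               N ⊞ B ≡ A ⊞ directionMatrix d ⊠ enlargement x →
               HasDirection (enlarge x F) (at c (vector F) A) (at c′ (vector F) B) d →
               c′ ≡ c ⊕ N · vector F
at-displaced x {F} p {c} {c′} A B N d N⊞B≡ move = ⊕-cancelʳ (B · v) (begin
  c′ ⊕ B · v                                           ≡⟨ ⊖⇒⊕ move ⟩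
  at c v A ⊕ directionMatrix d · vector (enlarge x F)  ≡⟨ cong (λ w → at c v A ⊕ directionMatrix d · w) (vector-enlarge x p) ⟩
  at c v A ⊕ directionMatrix d · (enlargement x · v)   ≡⟨ cong (at c v A ⊕_) (sym (·-⊠ (directionMatrix d) (enlargement x) v)) ⟩
  at c v A ⊕ (directionMatrix d ⊠ enlargement x) · v   ≡⟨ sym (at-⊞ c v A (directionMatrix d ⊠ enlargement x)) ⟩
  at c v (A ⊞ directionMatrix d ⊠ enlargement x)       ≡⟨ cong (at c v) (sym N⊞B≡) ⟩
  at c v (N ⊞ B)                                       ≡⟨ at-⊞ c v N B ⟩
  (c ⊕ N · v) ⊕ B · v                                  ∎)
  where
  open ≡-Reasoning
  v = vector F

shell-move : ∀ σ {M} → Proper M → ∀ i j {c c′ : Square} → Central (vector M) c → Central (vector M) c′ →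
             Move (enlarge (signLift σ) M) (at c (vector M) (shiftMatrix (signLift σ) i))
                                           (at c′ (vector M) (shiftMatrix (signLift σ) j)) → c′ ≡ c
shell-move σ {M} p i j {c} {c′} c-core c′-core move with translation⇒direction (enlarge (signLift σ) M) move
... | d , move-d =
  central-displacement p {c} {c′} (shellMove σ i j d) c-core c′-core
    (at-displaced (signLift σ) p {c} {c′} (shiftMatrix (signLift σ) i) (shiftMatrix (signLift σ) j)
                  (shellMove σ i j d) d (shellMove-shift σ i j d) move-d)
    (shellMove-trivial σ i j d)

-- All squares of a shell cycle have the same position c relative to the centers
-- of their subboards.
shellCycle-translate : ∀ σ {r s} → r ≢ 0 → r ℕ.< s → ∀ {C} → IsShellCycle (enlarge (signLift σ) (r , s)) C →
  ∀ (a : Direction → Square) → (∀ i → a i ∈ C) → (∀ i → Section (enlarge (signLift σ) (r , s)) i (a i)) →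
  ∃ λ c → ∀ i → a i ≡ at c (+ r , + s) (shiftMatrix (signLift σ) i)
shellCycle-translate σ {r} {s} r≢0 r<s {C} C-shell a a∈C a∈section = result C-shell a∈C
  where
  M : Frame
  M = r , s
  o = signLift σ
  p : Proper M
  p = ℕ.<⇒≤ r<s

  -- The square x has position c relative to the center of its subboard.
  record CellOf (c x : Square) : Set where
    pattern
    constructor cellOf
    field
      direction : Direction
      inShell   : InShell σ M direction x
      central   : Central (vector M) c
      located   : x ≡ at c (vector M) (shiftMatrix o direction)

  cell : ∀ {x} → Shell (enlarge o M) x → ∃ λ c → CellOf c x
  cell {x} x-shell = go (shell-inShell σ r≢0 r<s x-shell)
    where
    go : (∃ λ i → InShell σ M i x) → ∃ λ c → CellOf c x
    go (i , x-i) = let c , c-core , x≡ = shell-central σ p x-i in c , cellOf i x-i c-core x≡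

  next : ∀ {c x y} → CellOf c x → Shell (enlarge o M) y → Move (enlarge o M) x y → CellOf c y
  next {c} {x} {y} (cellOf i _ c-core x≡) y-shell move = go (cell y-shell)
    where
    go : (∃ λ c′ → CellOf c′ y) → CellOf c y
    go (c′ , cellOf j y-j c′-core y≡) = cellOf j y-j c-core
      (trans y≡ (cong (λ c → at c (vector M) (shiftMatrix o j))
        (shell-move σ p i j {c} {c′} c-core c′-core (subst₂ (Move (enlarge o M)) x≡ y≡ move))))

  along : ∀ {c x xs z} → CellOf c x → All (Shell (enlarge o M)) xs →
          All (uncurry (Move (enlarge o M))) (zip (x ∷ xs) (xs ∷ʳ z)) → All (CellOf c) (x ∷ xs)
  along x-cell [] _ = x-cell ∷ []
  along x-cell (y-shell ∷ shells) (move ∷ moves) = x-cell ∷ along (next x-cell y-shell move) shells moves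

  position : ∀ {c} i → CellOf c (a i) → a i ≡ at c (vector M) (shiftMatrix o i)
  position {c} i (cellOf j a-j _ a≡) = trans a≡ (cong (λ j → at c (vector M) (shiftMatrix o j))
    (inSection-unique {enlarge o M} (enlarge-proper o p) (inShell-inSection σ p a-j)
      (section-inSection (enlarge o M) i (a i) (a∈section i))))

  result : ∀ {C} → IsShellCycle (enlarge o M) C → (∀ i → a i ∈ C) →
           ∃ λ c → ∀ i → a i ≡ at c (vector M) (shiftMatrix o i)
  result {[]} _ a∈C = ⊥-elim (¬Any[] (a∈C 0F))
  result {x ∷ xs} record { isCycle = C-cycle ; inShell = x-shell ∷ shells } a∈C = go (cell x-shell)
    where
    go : (∃ λ c → CellOf c x) → ∃ λ c → ∀ i → a i ≡ at c (vector M) (shiftMatrix o i)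
    go (c , x-cell) = c , λ i → position i (All.lookup (along x-cell shells (IsCycle.moves C-cycle)) (a∈C i))

-- Closed walks and potentials

-- If the labels are the differences of a potential, then their matrices along a
-- closed walk add up to zero.
telescope : ∀ {V : Set} (Φ : V → Matrix) {vs ds} →
            Pointwise (λ (a , b) d → Φ b ≡ Φ a ⊞ directionMatrix d) (steps vs) ds → directionSum ds ≡ O
telescope Φ {[]}         [] = refl
telescope {V} Φ {v ∷ vs} ps = sym (⊞-cancelˡ (Φ v) (trans (⊞-identityʳ (Φ v)) (go v vs ps)))
  where
  go : ∀ v vs {w ds} → Pointwise (λ (a , b) d → Φ b ≡ Φ a ⊞ directionMatrix d) (zip (v ∷ vs) (vs ∷ʳ w)) ds →
       Φ w ≡ Φ v ⊞ directionSum ds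
  go v []       {ds = d ∷ []} (p ∷ []) = trans p (cong (Φ v ⊞_) (sym (⊞-identityʳ (directionMatrix d))))
  go v (u ∷ us) {ds = d ∷ ds} (p ∷ ps) =
    trans (go u us ps) (trans (cong (_⊞ directionSum ds) p) (⊞-assoc (Φ v) (directionMatrix d) (directionSum ds)))

zip-map² : ∀ {A B : Set} (f : A → B) xs ys → zip (map f xs) (map f ys) ≡ map (Product.map f f) (zip xs ys)
zip-map² f []       ys       = refl
zip-map² f (x ∷ xs) []       = refl
zip-map² f (x ∷ xs) (y ∷ ys) = cong ((f x , f y) ∷_) (zip-map² f xs ys)

steps-map : ∀ {A B : Set} (f : A → B) xs → steps (map f xs) ≡ map (Product.map f f) (steps xs)
steps-map f []       = refl
steps-map f (x ∷ xs) =
  trans (cong (zip (map f (x ∷ xs))) (sym (List.map-++ f xs [ x ]))) (zip-map² f (x ∷ xs) (xs ∷ʳ x))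

∈-zip : ∀ {A : Set} {x y : A} xs ys → (x , y) ∈ zip xs ys → x ∈ xs × y ∈ ys
∈-zip (x ∷ xs) (y ∷ ys) (here refl) = here refl , here refl
∈-zip (x ∷ xs) (y ∷ ys) (there p)   = Product.map there there (∈-zip xs ys p)

∈-steps : ∀ {A : Set} {x y : A} xs → (x , y) ∈ steps xs → x ∈ xs × y ∈ xs
∈-steps (x ∷ xs) p with ∈-zip (x ∷ xs) (xs ∷ʳ x) p
... | x∈ , y∈ with ∈-++⁻ xs y∈
... | inj₁ y∈xs        = x∈ , there y∈xs
... | inj₂ (here y≡x)  = x∈ , here y≡x

unique-map-injective : ∀ {A B : Set} {f : A → B} {xs} → Unique (map f xs) →
                       ∀ {x y} → x ∈ xs → y ∈ xs → f x ≡ f y → x ≡ y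
unique-map-injective (_  ∷ u) (here refl) (here refl) _  = refl
unique-map-injective {f = f} (x# ∷ u) (here refl) (there y∈)  eq = ⊥-elim (All.lookup x# (∈-map⁺ f y∈) eq)
unique-map-injective {f = f} (x# ∷ u) (there x∈)  (here refl) eq = ⊥-elim (All.lookup x# (∈-map⁺ f x∈) (sym eq))
unique-map-injective (_  ∷ u) (there x∈)  (there y∈)  eq = unique-map-injective u x∈ y∈ eq

-- Direction graphs of realized formal cycles

-- The squares of D are distinct and are those for which the formal squares of 𝒟
-- stand, where M is an (r , s)-leaper with 0 < r < s.
record Realization (𝒟 : List Matrix) (M : Leaper) (D : List Square) : Set where
  field
    nonzero : proj₁ M ≢ 0
    ordered : proj₁ M ℕ.< proj₂ M
    center  : Square
    located : D ≡ map (at center (vector M)) 𝒟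
    unique  : Unique D

-- The arcs of the direction graph of a formal cycle.
FormalArc : List Matrix → Matrix → Matrix → SkewDirection → Set
FormalArc 𝒟 A B d = ((A , B) ∈ steps 𝒟 ⊎ (B , A) ∈ steps 𝒟) × B ≡ A ⊞ directionMatrix d

formalArc-sym : ∀ {𝒟 A B} d → FormalArc 𝒟 A B d → FormalArc 𝒟 B A (opposite d)
formalArc-sym d (adjacent , eq) = Sum.swap adjacent , move-back d eq

at-direction : ∀ c L A {B} d → B ≡ A ⊞ directionMatrix d → HasDirection L (at c (vector L) A) (at c (vector L) B) d
at-direction c L A d refl = ⊕⇒⊖ {at c (vector L) A} (at-⊞ c (vector L) A (directionMatrix d))

-- The direction graph extracted from a realization, in terms of the formal cycle.
module Realized {𝒟 : List Matrix} (formal : All (uncurry Step) (steps 𝒟))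
                {M : Leaper} {D : List Square} (R : Realization 𝒟 M D) where
  open Realization R

  v : Square
  v = vector M

  f : Matrix → Square
  f = at center v

  open LabeledGraph (extracted M D)

  private
    preimage : (x : Vertex) → ∃ λ A → A ∈ 𝒟 × proj₁ x ≡ f A
    preimage (a , a∈D) = ∈-map⁻ f (subst (a ∈_) located a∈D)

  -- The formal square at a vertex; it is the potential of the vertex.
  position : Vertex → Matrix
  position x = proj₁ (preimage x)

  position-∈ : ∀ x → position x ∈ 𝒟
  position-∈ x = proj₁ (proj₂ (preimage x))

  square≡ : ∀ x → proj₁ x ≡ f (position x)
  square≡ x = proj₂ (proj₂ (preimage x))

  f-injective : ∀ {A B} → A ∈ 𝒟 → B ∈ 𝒟 → f A ≡ f B → A ≡ B
  f-injective = unique-map-injective (subst Unique located unique)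

  vertex≡ : ∀ {x y : Vertex} → proj₁ x ≡ proj₁ y → x ≡ y
  vertex≡ {x} {_ , y∈} refl = cong (proj₁ x ,_) (unique⇒irrelevant unique (proj₂ x) y∈)

  vertexAt : ∀ {A} → A ∈ 𝒟 → Vertex
  vertexAt {A} A∈ = f A , subst (f A ∈_) (sym located) (∈-map⁺ f A∈)

  position-vertexAt : ∀ {A} (A∈ : A ∈ 𝒟) → position (vertexAt A∈) ≡ A
  position-vertexAt A∈ = f-injective (position-∈ (vertexAt A∈)) A∈ (sym (square≡ (vertexAt A∈)))

  steps≡ : steps D ≡ map (Product.map f f) (steps 𝒟)
  steps≡ = trans (cong steps located) (steps-map f 𝒟)

  step-position : ∀ x y → (proj₁ x , proj₁ y) ∈ steps D → (position x , position y) ∈ steps 𝒟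
  step-position x y xy∈ = go (∈-map⁻ (Product.map f f) (subst ((proj₁ x , proj₁ y) ∈_) steps≡ xy∈))
    where
    go : (∃ λ AB → AB ∈ steps 𝒟 × (proj₁ x , proj₁ y) ≡ Product.map f f AB) → (position x , position y) ∈ steps 𝒟
    go ((A , B) , AB∈ , eq) = subst (_∈ steps 𝒟)
      (cong₂ _,_ (f-injective (proj₁ (∈-steps 𝒟 AB∈)) (position-∈ x) (trans (sym (cong proj₁ eq)) (square≡ x)))
                 (f-injective (proj₂ (∈-steps 𝒟 AB∈)) (position-∈ y) (trans (sym (cong proj₂ eq)) (square≡ y))))
      AB∈

  position-step : ∀ x y → (position x , position y) ∈ steps 𝒟 → (proj₁ x , proj₁ y) ∈ steps D
  position-step x y xy∈ = subst₂ (λ a b → (a , b) ∈ steps D) (sym (square≡ x)) (sym (square≡ y))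
    (subst ((f (position x) , f (position y)) ∈_) (sym steps≡) (∈-map⁺ (Product.map f f) xy∈))

  label : ∀ x y d → Step (position x) (position y) → HasDirection M (proj₁ x) (proj₁ y) d →
          position y ≡ position x ⊞ directionMatrix d
  label x y d (step d′ eq) direction = subst (λ d → position y ≡ position x ⊞ directionMatrix d)
    (direction-injective nonzero ordered {d′} {d} (trans (sym (at-direction center M (position x) d′ eq))
      (subst₂ (λ a b → HasDirection M a b d) (square≡ x) (square≡ y) direction))) eq

  arc⇒formal : ∀ x y d → Arc x y d → FormalArc 𝒟 (position x) (position y) d
  arc⇒formal x y d (inj₁ xy∈ , direction) = inj₁ xy∈′ , label x y d (All.lookup formal xy∈′) direction
    where xy∈′ = step-position x y xy∈
  arc⇒formal x y d (inj₂ yx∈ , direction) = inj₂ yx∈′ , label x y d (step-sym (All.lookup formal yx∈′)) direction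
    where yx∈′ = step-position y x yx∈

  formal⇒arc : ∀ x y d → FormalArc 𝒟 (position x) (position y) d → Arc x y d
  formal⇒arc x y d (adjacent , eq) =
    Sum.map (position-step x y) (position-step y x) adjacent ,
    subst₂ (λ a b → HasDirection M a b d) (sym (square≡ x)) (sym (square≡ y)) (at-direction center M (position x) d eq)

  isDirectionGraph : IsDirectionGraph (extracted M D)
  isDirectionGraph = record
    { symmetric = λ {x} {y} {d} xy → opposite d , formal⇒arc y x (opposite d) (formalArc-sym {𝒟} d (arc⇒formal x y d xy))
    ; zeroSum   = λ vs ds _ arcs → telescope position {vs}
                    (Pointwise.map (λ {xy} {d} arc → proj₂ (arc⇒formal (proj₁ xy) (proj₂ xy) d arc)) arcs)
    }

  isCycle : 3 ≤ length 𝒟 → IsCycle M D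
  isCycle long = record
    { long   = subst (3 ≤_) (sym (trans (cong length located) (List.length-map f 𝒟))) long
    ; simple = unique
    ; moves  = subst (All (uncurry (Move M))) (sym steps≡)
                 (All.map⁺ (All.map (λ { {A , B} (step d eq) →
                   subst (Translation M) (sym (at-direction center M A d eq)) (direction⇒translation M d) }) formal))
    }

  trivial : 3 ≤ length 𝒟 → Trivial M D
  trivial long = record
    { isCycle    = isCycle long
    ; directions = directions formal
    ; directed   = subst (λ ss → Pointwise _ ss (directions formal)) (sym steps≡) (directed formal)
    ; zeroSum    = telescope id {𝒟} (labeled formal)
    }
    where
    directions : ∀ {ss} → All (uncurry Step) ss → List SkewDirection
    directions []       = []
    directions (s ∷ ss) = Step.direction s ∷ directions ss

    labeled : ∀ {ss} (steps : All (uncurry Step) ss) →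
              Pointwise (λ (A , B) d → B ≡ A ⊞ directionMatrix d) ss (directions steps)
    labeled []       = []
    labeled (s ∷ ss) = Step.moves s ∷ labeled ss

    directed : ∀ {ss} (steps : All (uncurry Step) ss) →
               Pointwise (λ (a , b) d → HasDirection M a b d) (map (Product.map f f) ss) (directions steps)
    directed []             = []
    directed {(A , _) ∷ _} (step d eq ∷ ss) = at-direction center M A d eq ∷ directed ss

module _ {𝒟 : List Matrix} (formal : All (uncurry Step) (steps 𝒟)) where

  -- The vertex of the second realization with the same formal square.
  transfer : ∀ {M D M′ D′} → Realization 𝒟 M D → Realization 𝒟 M′ D′ →
             LabeledGraph.Vertex (extracted M D) → LabeledGraph.Vertex (extracted M′ D′)
  transfer R R′ x = Realized.vertexAt formal R′ (Realized.position-∈ formal R x)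

  position-transfer : ∀ {M D M′ D′} (R : Realization 𝒟 M D) (R′ : Realization 𝒟 M′ D′) x →
                      Realized.position formal R′ (transfer R R′ x) ≡ Realized.position formal R x
  position-transfer R R′ x = Realized.position-vertexAt formal R′ (Realized.position-∈ formal R x)

  transfer-inverse : ∀ {M D M′ D′} (R : Realization 𝒟 M D) (R′ : Realization 𝒟 M′ D′) x →
                     transfer R′ R (transfer R R′ x) ≡ x
  transfer-inverse R R′ x = Realized.vertex≡ formal R
    (trans (cong (Realized.f formal R) (position-transfer R R′ x)) (sym (Realized.square≡ formal R x)))

  realizations-isomorphic : ∀ {M D M′ D′} → Realization 𝒟 M D → Realization 𝒟 M′ D′ →
                            extracted M D ≅ extracted M′ D′
  realizations-isomorphic R R′ = record
    { vertices = mk↔ₛ′ (transfer R R′) (transfer R′ R) (transfer-inverse R′ R) (transfer-inverse R R′)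
    ; arcs     = λ x y d → mk⇔
        (λ arc → Realized.formal⇒arc formal R′ (transfer R R′ x) (transfer R R′ y) d
          (subst₂ (λ A B → FormalArc 𝒟 A B d) (sym (position-transfer R R′ x)) (sym (position-transfer R R′ y))
            (Realized.arc⇒formal formal R x y d arc)))
        (λ arc → Realized.formal⇒arc formal R x y d
          (subst₂ (λ A B → FormalArc 𝒟 A B d) (position-transfer R R′ x) (position-transfer R R′ y)
            (Realized.arc⇒formal formal R′ (transfer R R′ x) (transfer R R′ y) d arc)))
    }

-- Canonical second leaper cycles

length-concatMap : ∀ {A B : Set} (a : B → List A) → (∀ i → 1 ≤ length (a i)) → ∀ l → length l ≤ length (concatMap a l)
length-concatMap a a-nonempty []      = z≤n
length-concatMap a a-nonempty (i ∷ l) = ℕ.≤-trans (ℕ.+-mono-≤ (a-nonempty i) (length-concatMap a a-nonempty l))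
  (ℕ.≤-reflexive (sym (List.length-++ (a i))))

formalCycle-long : ∀ e o → 3 ≤ length (formalCycle e o)
formalCycle-long e o = ℕ.≤-trans (s≤s (s≤s (s≤s z≤n)))
  (length-concatMap (formalPaths e o) (λ i → nonempty (Coherent.walk (formal-coherent e o) i)) (arc 0F 0 7))
  where
  nonempty : ∀ {A B As} → Walk A As B → 1 ≤ length As
  nonempty (stop _) = s≤s z≤n
  nonempty (_ ∷ _)  = s≤s z≤n

-- Here the origin is not assumed to be 𝚐 or 𝚑: this follows from the existence
-- of a shell cycle.
realization : ∀ e o t {C′} (a : Direction → Square) → let M = enlarge* t (1 , 2) in Skew M →
              IsShellCycle (enlarge o M) C′ → (∀ i → a i ∈ C′) → (∀ i → Section (enlarge o M) i (a i)) →
              Realization (formalCycle e o) M (join (liftPaths* e (enlarge o M) (λ i → [ a i ])))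
realization e o t {C′} a (r≢0 , _ , r≢s) C′-shell a∈C′ a∈section =
  go (shell-origin o r≢0 r<s (All.lookup (IsShellCycle.inShell C′-shell) (a∈C′ 0F)))
  where
  M : Frame
  M = enlarge* t (1 , 2)
  p : Proper M
  p = enlarge*-proper t (s≤s z≤n)
  r<s : proj₁ M ℕ.< proj₂ M
  r<s = ℕ.≤∧≢⇒< p r≢s

  placed : Placed (enlarge o M) (λ i → [ a i ])
  placed = record
    { distinct = λ i → [] ∷ []
    ; placed   = λ i → section-inSection (enlarge o M) i (a i) (a∈section i) ∷ []
    }

  go : (∃ λ σ → o ≡ signLift σ) → Realization (formalCycle e o) M (join (liftPaths* e (enlarge o M) (λ i → [ a i ])))
  go (σ , refl) = record
    { nonzero = r≢0
    ; ordered = r<s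
    ; center  = proj₁ position
    ; located = join-at e o (proj₁ position) a p (proj₂ position)
    ; unique  = join-unique (enlarge*-proper e (enlarge-proper o p))
                            (liftPaths*-placed e (enlarge-proper o p) placed)
    }
    where position = shellCycle-translate σ r≢0 r<s C′-shell a a∈C′ a∈section

canonical-realization : ∀ X → let open CanonicalCycle X in Realization (formalCycle e o) M D
canonical-realization X =
  go t F′ M origin (Descends.frame descends) canonical M-skew (Descends.shellCycle descends) a∈Section
  where
  open CanonicalCycle X
  go : ∀ t F′ M → head t ≡ just o → HasDescent F′ t → M ≡ canonicalSecondLeaper t → Skew M → IsShellCycle F′ C′ →
       (∀ i → Section F′ i (a i)) → Realization (formalCycle e o) M (join (liftPaths* e F′ (λ i → [ a i ])))
  go (_ ∷ t) _ _ refl refl refl skew C′-shell a∈section = realization e o t a skew C′-shell a∈C′ a∈section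

-- Uniqueness of descents

-- The two frames have the same ratio n / m.
Proportional : Frame → Frame → Set
Proportional (m , n) (m′ , n′) = n * m′ ≡ n′ * m

-- A frame with 0 < m < n.
record Strict (F : Frame) : Set where
  constructor strict
  field
    positive : 0 < proj₁ F
    ordered  : proj₁ F < proj₂ F

enlarge-strict : ∀ x {F} → Strict F → Strict (enlarge x F)
enlarge-strict 𝚏 {m , n} (strict 0<m m<n) = strict 0<m (ℕ.<-≤-trans m<n (ℕ.m≤n+m n (2 * m)))
enlarge-strict 𝚐 {m , n} (strict 0<m m<n) = strict (ℕ.<-trans 0<m m<n)
  (ℕ.≤-trans (ℕ.≤-reflexive (cong suc (sym (ℕ.m+n∸n≡m n m))))
    (ℕ.∸-monoˡ-< (ℕ.+-monoʳ-< n (subst (m <_) (sym (ℕ.+-identityʳ n)) m<n)) (ℕ.m≤n+m m n)))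
enlarge-strict 𝚑 {m , n} (strict 0<m m<n) = strict (ℕ.<-trans 0<m m<n)
  (ℕ.<-≤-trans (ℕ.m<n+m n 0<m) (ℕ.+-monoʳ-≤ m (ℕ.m≤m+n n _)))

-- The proportions of the leaper of a given descent.
frameOf : Descent → Frame
frameOf e = enlarge* e (1 , 2)

frameOf-strict : ∀ e → Strict (frameOf e)
frameOf-strict []      = strict (s≤s z≤n) (s≤s (s≤s z≤n))
frameOf-strict (x ∷ e) = enlarge-strict x (frameOf-strict e)

-- The ratios n / m of the frames produced by a lift: more than 3, less than 2,
-- and between 2 and 3. The initial frame has ratio 2.
Range : LiftType → Frame → Set
Range 𝚏 (m , n) = 3 * m < n
Range 𝚐 (m , n) = n < 2 * m
Range 𝚑 (m , n) = 2 * m < n × n < 3 * m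

enlarge-range : ∀ x {F} → Strict F → Range x (enlarge x F)
enlarge-range 𝚏 {m , n} (strict 0<m m<n) = subst (_< 2 * m + n) (lemma m) (ℕ.+-monoʳ-< (2 * m) m<n)
  where
  lemma : ∀ m → 2 * m + m ≡ 3 * m
  lemma = solveℕ-∀
enlarge-range 𝚐 {m , n} (strict 0<m m<n) =
  ℕ.∸-monoʳ-< {2 * n} {m} {0} 0<m (ℕ.≤-trans (ℕ.<⇒≤ m<n) (ℕ.m≤m+n n _))
enlarge-range 𝚑 {m , n} (strict 0<m m<n) = ℕ.m<n+m (2 * n) 0<m , ℕ.+-monoˡ-< (2 * n) m<n

proportional-< : ∀ k F G → Strict F → Strict G → Proportional F G → proj₂ F < k * proj₁ F → proj₂ G < k * proj₁ G
proportional-< k (m , n) (m′ , n′) (strict 0<m _) (strict 0<m′ _) eq n<km =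
  ℕ.*-cancelʳ-< m n′ (k * m′) (subst₂ _<_ eq (lemma k m m′) (ℕ.*-monoˡ-< m′ {{ℕ.>-nonZero 0<m′}} n<km))
  where
  lemma : ∀ k m m′ → k * m * m′ ≡ k * m′ * m
  lemma = solveℕ-∀

proportional-> : ∀ k F G → Strict F → Strict G → Proportional F G → k * proj₁ F < proj₂ F → k * proj₁ G < proj₂ G
proportional-> k (m , n) (m′ , n′) (strict 0<m _) (strict 0<m′ _) eq km<n =
  ℕ.*-cancelʳ-< m (k * m′) n′ (subst₂ _<_ (lemma k m m′) eq (ℕ.*-monoˡ-< m′ {{ℕ.>-nonZero 0<m′}} km<n))
  where
  lemma : ∀ k m m′ → k * m * m′ ≡ k * m′ * m
  lemma = solveℕ-∀

range-proportional : ∀ x F G → Strict F → Strict G → Proportional F G → Range x F → Range x G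
range-proportional 𝚏 F G F⁺ G⁺ eq r         = proportional-> 3 F G F⁺ G⁺ eq r
range-proportional 𝚐 F G F⁺ G⁺ eq r         = proportional-< 2 F G F⁺ G⁺ eq r
range-proportional 𝚑 F G F⁺ G⁺ eq (r₁ , r₂) = proportional-> 2 F G F⁺ G⁺ eq r₁ , proportional-< 3 F G F⁺ G⁺ eq r₂

range-unique : ∀ x y F → Range x F → Range y F → x ≡ y
range-unique 𝚏 𝚏 _ _ _ = refl
range-unique 𝚐 𝚐 _ _ _ = refl
range-unique 𝚑 𝚑 _ _ _ = refl
range-unique 𝚏 𝚐 (m , n) r s = contradiction s (ℕ.<-asym (ℕ.≤-<-trans (ℕ.m≤n+m (2 * m) m) r))
range-unique 𝚐 𝚏 (m , n) r s = contradiction r (ℕ.<-asym (ℕ.≤-<-trans (ℕ.m≤n+m (2 * m) m) s))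
range-unique 𝚏 𝚑 _ r (_ , s) = contradiction s (ℕ.<-asym r)
range-unique 𝚑 𝚏 _ (_ , r) s = contradiction r (ℕ.<-asym s)
range-unique 𝚐 𝚑 _ r (s , _) = contradiction s (ℕ.<-asym r)
range-unique 𝚑 𝚐 _ (r , _) s = contradiction r (ℕ.<-asym s)

range-≢ : ∀ x {m n} → Range x (m , n) → n ≢ 2 * m
range-≢ 𝚏 {m} r n≡2m = ℕ.<⇒≢ (ℕ.≤-<-trans (ℕ.m≤n+m (2 * m) m) r) (sym n≡2m)
range-≢ 𝚐 r n≡2m = ℕ.<⇒≢ r n≡2m
range-≢ 𝚑 (r , _) n≡2m = ℕ.<⇒≢ r (sym n≡2m)

enlarge-proportional : ∀ x F G → Strict F → Strict G →
                       Proportional (enlarge x F) (enlarge x G) → Proportional F G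
enlarge-proportional 𝚏 (m , n) (m′ , n′) _ _ eq =
  ℕ.+-cancelˡ-≡ (2 * m * m′) _ _ (trans (lemma m m′ n) (trans eq (lemma′ m m′ n′)))
  where
  lemma : ∀ m m′ n → 2 * m * m′ + n * m′ ≡ (2 * m + n) * m′
  lemma = solveℕ-∀
  lemma′ : ∀ m m′ n′ → (2 * m′ + n′) * m ≡ 2 * m * m′ + n′ * m
  lemma′ = solveℕ-∀
enlarge-proportional 𝚐 (m , n) (m′ , n′) (strict _ m<n) (strict _ m′<n′) eq =
  trans (ℕ.*-comm n m′) (trans (sym (ℕ.∸-cancelˡ-≡ (bound n′ m<n) small′ (begin
    2 * n * n′ ∸ m * n′    ≡⟨ sym (ℕ.*-distribʳ-∸ n′ (2 * n) m) ⟩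
    (2 * n ∸ m) * n′       ≡⟨ eq ⟩
    (2 * n′ ∸ m′) * n      ≡⟨ ℕ.*-distribʳ-∸ n (2 * n′) m′ ⟩
    2 * n′ * n ∸ m′ * n    ≡⟨ cong (_∸ m′ * n) (swap n′ n) ⟩
    2 * n * n′ ∸ m′ * n    ∎))) (ℕ.*-comm m n′))
  where
  open ≡-Reasoning
  swap : ∀ a b → 2 * a * b ≡ 2 * b * a
  swap = solveℕ-∀
  bound : ∀ {m n} k → m < n → m * k ≤ 2 * n * k
  bound {m} {n} k m<n = ℕ.*-monoˡ-≤ k (ℕ.≤-trans (ℕ.<⇒≤ m<n) (ℕ.m≤m+n n _))
  small′ : m′ * n ≤ 2 * n * n′
  small′ = subst (m′ * n ≤_) (swap n′ n) (bound n m′<n′)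
enlarge-proportional 𝚑 (m , n) (m′ , n′) _ _ eq =
  trans (ℕ.*-comm n m′) (trans (sym (ℕ.+-cancelʳ-≡ (2 * n * n′) (m * n′) (m′ * n)
    (trans (lemma m n n′) (trans eq (lemma′ m′ n n′))))) (ℕ.*-comm m n′))
  where
  lemma : ∀ m n n′ → m * n′ + 2 * n * n′ ≡ (m + 2 * n) * n′
  lemma = solveℕ-∀
  lemma′ : ∀ m′ n n′ → (m′ + 2 * n′) * n ≡ m′ * n + 2 * n * n′
  lemma′ = solveℕ-∀

-- The ratio of a frame determines the last lift and the ratio before it.
descent-unique : ∀ e e′ → Proportional (frameOf e) (frameOf e′) → e ≡ e′
descent-unique [] [] _ = refl
descent-unique [] (x ∷ e′) eq =
  contradiction refl (range-≢ x {1} {2} (range-proportional x (frameOf (x ∷ e′)) (frameOf []) (frameOf-strict (x ∷ e′)) (frameOf-strict [])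
    (sym eq) (enlarge-range x (frameOf-strict e′))))
descent-unique (x ∷ e) [] eq =
  contradiction refl (range-≢ x {1} {2} (range-proportional x (frameOf (x ∷ e)) (frameOf []) (frameOf-strict (x ∷ e)) (frameOf-strict [])
    eq (enlarge-range x (frameOf-strict e))))
descent-unique (x ∷ e) (y ∷ e′) eq with range-unique x y (frameOf (y ∷ e′))
  (range-proportional x (frameOf (x ∷ e)) (frameOf (y ∷ e′)) (frameOf-strict (x ∷ e)) (frameOf-strict (y ∷ e′))
    eq (enlarge-range x (frameOf-strict e)))
  (enlarge-range y (frameOf-strict e′))
... | refl = cong (x ∷_) (descent-unique e e′ (enlarge-proportional x (frameOf e) (frameOf e′) (frameOf-strict e) (frameOf-strict e′) eq))

-- Even continued fractions

-- The inclusion of the natural numbers in the rationals.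
ι : ℕ → ℚ
ι n = + n ℚ./ 1

ι-+ : ∀ a b → ι (a + b) ≡ ι a ℚ.+ ι b
ι-+ a b = ℚ.toℚᵘ-injective (begin
  toℚᵘ (ι (a + b))                         ≈⟨ ℚ.toℚᵘ-fromℚᵘ (mkℚᵘ (+ (a + b)) 0) ⟩
  mkℚᵘ (+ (a + b)) 0                       ≈⟨ *≡* (cong (ℤ._* + 1) (cong₂ ℤ._+_ (sym (ℤ.*-identityʳ (+ a))) (sym (ℤ.*-identityʳ (+ b))))) ⟩
  mkℚᵘ (+ a) 0 ℚᵘ.+ mkℚᵘ (+ b) 0           ≈⟨ ℚᵘ.+-cong (ℚ.toℚᵘ-fromℚᵘ (mkℚᵘ (+ a) 0)) (ℚ.toℚᵘ-fromℚᵘ (mkℚᵘ (+ b) 0)) ⟨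
  toℚᵘ (ι a) ℚᵘ.+ toℚᵘ (ι b)               ≈⟨ ℚ.toℚᵘ-homo-+ (ι a) (ι b) ⟨
  toℚᵘ (ι a ℚ.+ ι b)                       ∎)
  where open ℚᵘ.≃-Reasoning

ι-* : ∀ a b → ι (a * b) ≡ ι a ℚ.* ι b
ι-* a b = ℚ.toℚᵘ-injective (begin
  toℚᵘ (ι (a * b))                         ≈⟨ ℚ.toℚᵘ-fromℚᵘ (mkℚᵘ (+ (a * b)) 0) ⟩
  mkℚᵘ (+ (a * b)) 0                       ≈⟨ *≡* (cong (ℤ._* + 1) (ℤ.pos-* a b)) ⟩
  mkℚᵘ (+ a) 0 ℚᵘ.* mkℚᵘ (+ b) 0           ≈⟨ ℚᵘ.*-cong (ℚ.toℚᵘ-fromℚᵘ (mkℚᵘ (+ a) 0)) (ℚ.toℚᵘ-fromℚᵘ (mkℚᵘ (+ b) 0)) ⟨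
  toℚᵘ (ι a) ℚᵘ.* toℚᵘ (ι b)               ≈⟨ ℚ.toℚᵘ-homo-* (ι a) (ι b) ⟨
  toℚᵘ (ι a ℚ.* ι b)                       ∎)
  where open ℚᵘ.≃-Reasoning

ι-injective : ∀ a b → ι a ≡ ι b → a ≡ b
ι-injective a b eq with ℚ.fromℚᵘ-injective {mkℚᵘ (+ a) 0} {mkℚᵘ (+ b) 0} eq
... | *≡* a≡b = ℤ.+-injective (trans (sym (ℤ.*-identityʳ (+ a))) (trans a≡b (ℤ.*-identityʳ (+ b))))

-- The value v is n / m, in a form that avoids division by m.
HasRatio : ℚ → Frame → Set
HasRatio v (m , n) = v ℚ.* ι m ≡ ι n

quotient-hasRatio : ∀ p q .{{_ : ℕ.NonZero p}} → HasRatio (+ q ℚ./ p) (p , q)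
quotient-hasRatio p@(suc p-1) q = ℚ.toℚᵘ-injective (begin
  toℚᵘ (+ q ℚ./ p ℚ.* ι p)                 ≈⟨ ℚ.toℚᵘ-homo-* (+ q ℚ./ p) (ι p) ⟩
  toℚᵘ (+ q ℚ./ p) ℚᵘ.* toℚᵘ (ι p)         ≈⟨ ℚᵘ.*-cong (ℚ.toℚᵘ-fromℚᵘ (mkℚᵘ (+ q) p-1)) (ℚ.toℚᵘ-fromℚᵘ (mkℚᵘ (+ p) 0)) ⟩
  mkℚᵘ (+ q) p-1 ℚᵘ.* mkℚᵘ (+ p) 0         ≈⟨ *≡* (trans (ℤ.*-identityʳ (+ q ℤ.* + p)) (cong (+ q ℤ.*_) (cong +_ (sym (ℕ.*-identityʳ p))))) ⟩
  mkℚᵘ (+ q) 0                             ≈⟨ ℚ.toℚᵘ-fromℚᵘ (mkℚᵘ (+ q) 0) ⟨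
  toℚᵘ (ι q)                               ∎)
  where open ℚᵘ.≃-Reasoning

hasRatio-proportional : ∀ v F G → HasRatio v F → HasRatio v G → Proportional F G
hasRatio-proportional v (m , n) (m′ , n′) eq eq′ = ι-injective (n * m′) (n′ * m) (begin
  ι (n * m′)              ≡⟨ ι-* n m′ ⟩
  ι n ℚ.* ι m′            ≡⟨ cong (ℚ._* ι m′) (sym eq) ⟩
  v ℚ.* ι m ℚ.* ι m′      ≡⟨ ℚ.*-assoc v (ι m) (ι m′) ⟩
  v ℚ.* (ι m ℚ.* ι m′)    ≡⟨ cong (v ℚ.*_) (ℚ.*-comm (ι m) (ι m′)) ⟩
  v ℚ.* (ι m′ ℚ.* ι m)    ≡⟨ sym (ℚ.*-assoc v (ι m′) (ι m)) ⟩
  v ℚ.* ι m′ ℚ.* ι m      ≡⟨ cong (ℚ._* ι m) eq′ ⟩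
  ι n′ ℚ.* ι m            ≡⟨ sym (ι-* n′ m) ⟩
  ι (n′ * m)              ∎)
  where open ≡-Reasoning

reciprocal : ∀ v .{{_ : ℚ.NonZero v}} F → HasRatio v F → 1/ v ℚ.* ι (proj₂ F) ≡ ι (proj₁ F)
reciprocal v (m , n) eq = begin
  1/ v ℚ.* ι n            ≡⟨ cong (1/ v ℚ.*_) (sym eq) ⟩
  1/ v ℚ.* (v ℚ.* ι m)    ≡⟨ sym (ℚ.*-assoc (1/ v) v (ι m)) ⟩
  1/ v ℚ.* v ℚ.* ι m      ≡⟨ cong (ℚ._* ι m) (ℚ.*-inverseˡ v) ⟩
  ℚ.1ℚ ℚ.* ι m            ≡⟨ ℚ.*-identityˡ (ι m) ⟩
  ι m                     ∎
  where open ≡-Reasoning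

sum-ratio : ∀ c w m n → w ℚ.* ι n ≡ ι m → (ι c ℚ.+ w) ℚ.* ι n ≡ ι (c * n + m)
sum-ratio c w m n eq = begin
  (ι c ℚ.+ w) ℚ.* ι n           ≡⟨ ℚ.*-distribʳ-+ (ι n) (ι c) w ⟩
  ι c ℚ.* ι n ℚ.+ w ℚ.* ι n     ≡⟨ cong₂ ℚ._+_ (sym (ι-* c n)) eq ⟩
  ι (c * n) ℚ.+ ι m             ≡⟨ sym (ι-+ (c * n) m) ⟩
  ι (c * n + m)                 ∎
  where open ≡-Reasoning

difference-ratio : ∀ c w m n → w ℚ.* ι n ≡ ι m → (ι c ℚ.- w) ℚ.* ι n ℚ.+ ι m ≡ ι (c * n)
difference-ratio c w m n eq = begin
  (ι c ℚ.- w) ℚ.* ι n ℚ.+ ι m                   ≡⟨ cong ((ι c ℚ.- w) ℚ.* ι n ℚ.+_) (sym eq) ⟩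
  (ι c ℚ.- w) ℚ.* ι n ℚ.+ w ℚ.* ι n             ≡⟨ sym (ℚ.*-distribʳ-+ (ι n) (ι c ℚ.- w) w) ⟩
  (ι c ℚ.- w ℚ.+ w) ℚ.* ι n                     ≡⟨ cong (ℚ._* ι n) (trans (ℚ.+-assoc (ι c) (ℚ.- w) w)
                                                     (trans (cong (ι c ℚ.+_) (ℚ.+-inverseˡ w)) (ℚ.+-identityʳ (ι c)))) ⟩
  ι c ℚ.* ι n                                   ≡⟨ sym (ι-* c n) ⟩
  ι (c * n)                                     ∎
  where open ≡-Reasoning

ℚ-+-cancelʳ : ∀ z {x y} → x ℚ.+ z ≡ y ℚ.+ z → x ≡ y
ℚ-+-cancelʳ z {x} {y} eq = trans (sym (undo x)) (trans (cong (ℚ._- z) eq) (undo y))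
  where
  undo : ∀ x → x ℚ.+ z ℚ.- z ≡ x
  undo x = trans (ℚ.+-assoc x z (ℚ.- z)) (trans (cong (x ℚ.+_) (ℚ.+-inverseʳ z)) (ℚ.+-identityʳ x))

enlarge*-𝚏 : ∀ k F → enlarge* (replicate k 𝚏) F ≡ (proj₁ F , k * (2 * proj₁ F) + proj₂ F)
enlarge*-𝚏 zero    F       = refl
enlarge*-𝚏 (suc k) (m , n) rewrite enlarge*-𝚏 k (m , n) = cong (m ,_) (sym (ℕ.+-assoc (2 * m) (k * (2 * m)) n))

frameOf-𝚏++ : ∀ k e → frameOf (replicate k 𝚏 ++ e) ≡ (proj₁ (frameOf e) , k * (2 * proj₁ (frameOf e)) + proj₂ (frameOf e))
frameOf-𝚏++ k e = trans (List.foldr-++ enlarge (1 , 2) (replicate k 𝚏) e) (enlarge*-𝚏 k (frameOf e))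

even-half : ∀ {c} → 2 ∣ c → 0 < c → c ≡ 2 * suc (c ℕ./ 2 ∸ 1)
even-half (divides (suc k) refl) _ =
  trans (ℕ.*-comm (suc k) 2) (cong (λ h → 2 * suc (h ∸ 1)) (sym (m*n/n≡m (suc k) 2)))

-- Prepending c ± to a fraction sends the ratio n / m to c ± m / n, which is a lift
-- of type 𝚑 or 𝚐, giving 2 ± m / n, followed by c / 2 - 1 lifts of type 𝚏, each
-- adding 2.
fraction-ratio : ∀ c {v} → AllPositiveEven c → c ⇓ v → HasRatio v (frameOf (fractionDescent c))
fraction-ratio ⟦ c ⟧ (2∣c , 0<c) (term .c) = subst (HasRatio (ι c)) (sym (enlarge*-𝚏 (c ℕ./ 2 ∸ 1) (1 , 2)))
  (trans (ℚ.*-identityʳ (ι c)) (cong ι (trans (even-half 2∣c 0<c) (lemma (c ℕ./ 2 ∸ 1)))))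
  where
  lemma : ∀ k → 2 * suc k ≡ k * (2 * 1) + 2
  lemma = solveℕ-∀
fraction-ratio (c ⟨ Sign.+ ⟩ r) ((2∣c , 0<c) , r-even) (more .c .Sign.+ {v = v} r⇓v) =
  subst (HasRatio w) (sym (frameOf-𝚏++ k (𝚑 ∷ fractionDescent r)))
    (trans (sum-ratio c (1/ v) m n (reciprocal v (frameOf (fractionDescent r)) (fraction-ratio r r-even r⇓v)))
      (cong ι (trans (cong (λ c → c * n + m) (even-half 2∣c 0<c)) (lemma k m n))))
  where
  w = ι c ℚ.+ 1/ v
  k = c ℕ./ 2 ∸ 1
  m = proj₁ (frameOf (fractionDescent r))
  n = proj₂ (frameOf (fractionDescent r))
  lemma : ∀ k m n → 2 * suc k * n + m ≡ k * (2 * n) + (m + 2 * n)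
  lemma = solveℕ-∀
fraction-ratio (c ⟨ Sign.- ⟩ r) ((2∣c , 0<c) , r-even) (more .c .Sign.- {v = v} r⇓v) =
  subst (HasRatio w) (sym (frameOf-𝚏++ k (𝚐 ∷ fractionDescent r)))
    (ℚ-+-cancelʳ (ι m) (trans (difference-ratio c (1/ v) m n (reciprocal v (frameOf (fractionDescent r)) (fraction-ratio r r-even r⇓v)))
      (trans (cong ι (begin
        c * n                                ≡⟨ cong (_* n) (even-half 2∣c 0<c) ⟩
        2 * suc k * n                        ≡⟨ lemma k n ⟩
        k * (2 * n) + 2 * n                  ≡⟨ cong (k * (2 * n) ℕ.+_) (sym (ℕ.m∸n+n≡m m≤2n)) ⟩
        k * (2 * n) + (2 * n ∸ m + m)        ≡⟨ sym (ℕ.+-assoc (k * (2 * n)) (2 * n ∸ m) m) ⟩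
        k * (2 * n) + (2 * n ∸ m) + m        ∎))
        (ι-+ (k * (2 * n) + (2 * n ∸ m)) m))))
  where
  open ≡-Reasoning
  w = ι c ℚ.- 1/ v
  k = c ℕ./ 2 ∸ 1
  m = proj₁ (frameOf (fractionDescent r))
  n = proj₂ (frameOf (fractionDescent r))
  m≤2n : m ≤ 2 * n
  m≤2n = ℕ.≤-trans (ℕ.<⇒≤ (Strict.ordered (frameOf-strict (fractionDescent r)))) (ℕ.m≤m+n n _)
  lemma : ∀ k n → 2 * suc k * n ≡ k * (2 * n) + 2 * n
  lemma = solveℕ-∀

-- A fraction with first term 0 is either 0 or less than 1 in absolute value, the
-- rest of it being greater than 1; so it is not q / p.
leading-positive : ∀ c {v p q} → IsEvenFraction c → c ⇓ v → HasRatio v (p , q) → p < q → AllPositiveEven c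
leading-positive ⟦ suc c ⟧ 2∣c _ _ _ = 2∣c , s≤s z≤n
leading-positive ⟦ zero ⟧ {p = p} {q} _ (term .0) eq p<q =
  contradiction (trans (sym (ℕ.*-identityʳ q)) (hasRatio-proportional (ι 0) (p , q) (1 , 0) eq refl))
                (ℕ.<⇒≢ (ℕ.≤-<-trans z≤n p<q) ∘ sym)
leading-positive (suc c ⟨ _ ⟩ r) (2∣c , r-even) _ _ _ = (2∣c , s≤s z≤n) , r-even
leading-positive (zero ⟨ Sign.+ ⟩ r) {p = p} {q} (_ , r-even) (more .0 .Sign.+ {v = v} r⇓v) eq p<q =
  contradiction (hasRatio-proportional (ι 0 ℚ.+ 1/ v) (n , m) (p , q)
                  (sum-ratio 0 (1/ v) m n (reciprocal v (frameOf (fractionDescent r)) (fraction-ratio r r-even r⇓v))) eq)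
                (ℕ.<⇒≢ (ℕ.<-≤-trans (ℕ.*-mono-< m<n p<q) (ℕ.≤-reflexive (ℕ.*-comm n q))))
  where
  m = proj₁ (frameOf (fractionDescent r))
  n = proj₂ (frameOf (fractionDescent r))
  m<n : m < n
  m<n = Strict.ordered (frameOf-strict (fractionDescent r))
leading-positive (zero ⟨ Sign.- ⟩ r) {p = p} {q} (_ , r-even) (more .0 .Sign.- {v = v} r⇓v) eq p<q =
  contradiction (ι-injective (q * n + m * p) 0 (begin
    ι (q * n + m * p)                       ≡⟨ trans (ι-+ (q * n) (m * p)) (cong₂ ℚ._+_ (ι-* q n) (ι-* m p)) ⟩
    ι q ℚ.* ι n ℚ.+ ι m ℚ.* ι p             ≡⟨ cong (λ z → z ℚ.* ι n ℚ.+ ι m ℚ.* ι p) (sym eq) ⟩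
    w ℚ.* ι p ℚ.* ι n ℚ.+ ι m ℚ.* ι p       ≡⟨ cong (ℚ._+ ι m ℚ.* ι p) (trans (ℚ.*-assoc w (ι p) (ι n))
                                                 (trans (cong (w ℚ.*_) (ℚ.*-comm (ι p) (ι n))) (sym (ℚ.*-assoc w (ι n) (ι p))))) ⟩
    w ℚ.* ι n ℚ.* ι p ℚ.+ ι m ℚ.* ι p       ≡⟨ sym (ℚ.*-distribʳ-+ (ι p) (w ℚ.* ι n) (ι m)) ⟩
    (w ℚ.* ι n ℚ.+ ι m) ℚ.* ι p             ≡⟨ cong (ℚ._* ι p) (difference-ratio 0 (1/ v) m n (reciprocal v (frameOf (fractionDescent r)) (fraction-ratio r r-even r⇓v))) ⟩
    ι 0 ℚ.* ι p                             ≡⟨ ℚ.*-zeroˡ (ι p) ⟩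
    ι 0                                     ∎))
    (ℕ.<⇒≢ (ℕ.<-≤-trans (ℕ.*-mono-< (ℕ.≤-<-trans z≤n p<q) (ℕ.≤-<-trans z≤n m<n)) (ℕ.m≤m+n (q * n) (m * p))) ∘ sym)
  where
  open ≡-Reasoning
  w = ι 0 ℚ.- 1/ v
  m = proj₁ (frameOf (fractionDescent r))
  n = proj₂ (frameOf (fractionDescent r))
  m<n : m < n
  m<n = Strict.ordered (frameOf-strict (fractionDescent r))

convergent-positive : ∀ c k → AllPositiveEven c → AllPositiveEven (convergent c k)
convergent-positive ⟦ c ⟧       k       c-even            = c-even
convergent-positive (c ⟨ s ⟩ r) zero    (c-even , _)      = c-even
convergent-positive (c ⟨ s ⟩ r) (suc k) (c-even , r-even) = c-even , convergent-positive r k r-even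

-- What follows the descent of a convergent in that of the fraction begins with
-- the lift type of the next sign.
convergent-prefix : ∀ c k → ∃ λ rest → fractionDescent c ≡ fractionDescent (convergent c k) ++ rest ×
                                       head rest ≡ Maybe.map signLift (signAfter c k)
convergent-prefix ⟦ c ⟧       k       = [] , sym (List.++-identityʳ (replicate (c ℕ./ 2 ∸ 1) 𝚏)) , refl
convergent-prefix (c ⟨ s ⟩ r) zero    = signLift s ∷ fractionDescent r , refl , refl
convergent-prefix (c ⟨ s ⟩ r) (suc k) =
  let rest , eq , head≡ = convergent-prefix r k in
  rest ,
  trans (cong (λ l → replicate (c ℕ./ 2 ∸ 1) 𝚏 ++ signLift s ∷ l) eq)
        (sym (List.++-assoc (replicate (c ℕ./ 2 ∸ 1) 𝚏) (signLift s ∷ fractionDescent (convergent r k)) rest)) ,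
  head≡

-- The direction graph and its data

type-fraction-positive : ∀ {X} (S : HasType X) → AllPositiveEven (HasType.fraction S)
type-fraction-positive {X} S = leading-positive fraction isEvenFraction value (quotient-hasRatio p q) p<q
  where
  open CanonicalCycle X
  open HasType S
  instance
    p≢0 : ℕ.NonZero p
    p≢0 = ℕ.≢-nonZero (proj₁ L-skew)

-- The descent of L is e followed by t, and also the descent of the fraction, in
-- which e is the descent of the convergent; so the first character of t is the
-- lift type of the sign after it.
origin-nextSign : ∀ {X} (S : HasType X) → just (CanonicalCycle.o X) ≡ Maybe.map signLift (HasType.nextSign S)
origin-nextSign {X} S = matches (convergent-prefix fraction k)
  where
  open CanonicalCycle X
  open HasType S
  instance
    p≢0 : ℕ.NonZero p
    p≢0 = ℕ.≢-nonZero (proj₁ L-skew)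

  whole : e ++ t ≡ fractionDescent fraction
  whole = descent-unique (e ++ t) (fractionDescent fraction)
    (hasRatio-proportional (+ q ℚ./ p) (frameOf (e ++ t)) (frameOf (fractionDescent fraction))
      (subst (HasRatio (+ q ℚ./ p)) (sym (Descends.descent descends)) (quotient-hasRatio p q))
      (fraction-ratio fraction (type-fraction-positive S) value))

  matches : (∃ λ rest → fractionDescent fraction ≡ fractionDescent (convergent fraction k) ++ rest ×
                        head rest ≡ Maybe.map signLift (signAfter fraction k)) →
            just o ≡ Maybe.map signLift nextSign
  matches (rest , split , head≡) = trans (sym origin) (trans (cong head t≡rest) head≡)
    where
    t≡rest : t ≡ rest
    t≡rest = List.++-cancelˡ e t rest (trans whole (trans split (cong (_++ rest) (sym isType))))

open CanonicalCycle using (M; D; e; o)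
open HasType using (kthConvergent; nextSign)

same-descent-origin : ∀ X Y → e X ≡ e Y → o X ≡ o Y → graph X ≅ graph Y
same-descent-origin X Y e≡ o≡ = realizations-isomorphic (formalCycle-steps (e X) (o X))
  (canonical-realization X)
  (subst₂ (λ e o → Realization (formalCycle e o) (M Y) (D Y)) (sym e≡) (sym o≡) (canonical-realization Y))

same-convergent-sign : ∀ X Y (S : HasType X) (T : HasType Y) v → kthConvergent S ⇓ v → kthConvergent T ⇓ v →
                       nextSign S ≡ nextSign T → graph X ≅ graph Y
same-convergent-sign X Y S T v S⇓v T⇓v sign≡ = same-descent-origin X Y
  (trans (HasType.isType S) (trans descents≡ (sym (HasType.isType T))))
  (just-injective (trans (origin-nextSign S) (trans (cong (Maybe.map signLift) sign≡) (sym (origin-nextSign T)))))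
  where
  ratio : ∀ {Z} (U : HasType Z) → kthConvergent U ⇓ v → HasRatio v (frameOf (fractionDescent (kthConvergent U)))
  ratio U = fraction-ratio (kthConvergent U)
    (convergent-positive (HasType.fraction U) (HasType.k U) (type-fraction-positive U))

  descents≡ : fractionDescent (kthConvergent S) ≡ fractionDescent (kthConvergent T)
  descents≡ = descent-unique (fractionDescent (kthConvergent S)) (fractionDescent (kthConvergent T))
    (hasRatio-proportional v (frameOf (fractionDescent (kthConvergent S))) (frameOf (fractionDescent (kthConvergent T)))
      (ratio S S⇓v) (ratio T T⇓v))

theorem11 : (∀ (X : CanonicalCycle) → Trivial (M X) (D X) × IsDirectionGraph (graph X))
    × (∀ (X Y : CanonicalCycle) → e X ≡ e Y → o X ≡ o Y → graph X ≅ graph Y)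
    × (∀ (X Y : CanonicalCycle) (S : HasType X) (T : HasType Y) →
    ∀ v → kthConvergent S ⇓ v → kthConvergent T ⇓ v →
    nextSign S ≡ nextSign T → graph X ≅ graph Y)
theorem11 =
  (λ X → let open Realized (formalCycle-steps (e X) (o X)) (canonical-realization X) in
         trivial (formalCycle-long (e X) (o X)) , isDirectionGraph) ,
  same-descent-origin ,
  same-convergent-sign
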